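{- Let $p$ be a prime with $p \equiv 3 \pmod{4}$. Then for all integers $\alpha \geq 0$ and $n \geq 0$, and for every integer $i$ with $1 \leq i \leq p-1$, $$\mathrm{RD}^{(4,9)}\left(12p^{2\alpha+1}(pn+i) + p^{2\alpha+2} + 1\right) \equiv 0 \pmod{4}.$$
   Context: For a nonnegative integer $n$, $\mathrm{RD}^{(4,9)}(n)$ denotes the number of partitions of $n$ into parts that are simultaneously 4-regular and 9-distinct, i.e., partitions of $n$ in which no part is divisible by $4$ and each distinct part appears at least once and at most $8$ times. Equivalently, writing $f_k = \prod_{m\ge1}(1-q^{km})$, $\sum_{n\ge0}\mathrm{RD}^{(4,9)}(n)q^n = \frac{f_9 f_4}{f_1 f_{36}}$. -}

module Defs where

open import Data.Nat using (ℕ; zero; suc; _+_; _*_; _∸_; _≤?_)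
open import Data.Nat.Divisibility using (_∣?_)
open import Data.List using (List; map; upTo; filter)
open import Data.Nat.ListAction using (sum)
open import Relation.Nullary.Decidable using (does)
open import Data.Bool using (if_then_else_)

-- Partitions counted via multiplicities.  A partition of n into parts that
-- are 4-regular (no part divisible by 4) and 9-distinct (each part occurring
-- at most 8 times) is determined by a multiplicity function
-- m : {1,2,...} → {0,...,8} with m(j) = 0 whenever 4 ∣ j and Σ j·m(j) = n.
--
-- rdUpTo n k = number of such partitions of n all of whose parts are ≤ k.
-- Recursion on the largest allowed part size k:
--   * k = 0 : only the empty partition, which partitions 0 only;
--   * part size (suc k) divisible by 4 : it may not occur;
--   * otherwise: choose its multiplicity m ∈ {0,…,8} with m·(suc k) ≤ n.
rdUpTo : ℕ → ℕ → ℕ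
rdUpTo zero    zero    = 1
rdUpTo (suc _) zero    = 0
rdUpTo n       (suc k) =
  if does (4 ∣? suc k)
  then rdUpTo n k
  else sum (map (λ m → rdUpTo (n ∸ m * suc k) k)
                (filter (λ m → m * suc k ≤? n) (upTo 9)))

-- RD^(4,9)(n): all parts of a partition of n are ≤ n.
RD49 : ℕ → ℕ
RD49 n = rdUpTo n n

{-# OPTIONS --safe #-}
-- Put X = q and y = -q in the ring of power series modulo 4, truncated so that X is nilpotent.
-- With ψ(y) = Σ y^(n(n+1)/2), φ(y) = Σ_{k ∈ ℤ} y^(k²) and D = f₁/f₄, the Jacobi triple product gives
-- ψ(y) D(q) = φ(y), while the generating function G satisfies G D(q) = D(q⁹); since φ² = 1 modulo 4,
--   G ψ(y⁹) = ψ(y) φ(y) φ(y⁹).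
-- Sorting exponents modulo 3, ψ(y) = A + y ψ(y⁹) with all exponents of A divisible by 3, and
-- φ(y) φ(y⁹) = 1 + 2T modulo 4, where T = Σ y^(k²) over the k ≥ 1 prime to 3.  Product formulas modulo 2
-- give A T = y ψ(y⁹), so that (G + y + 2 y T) ψ(y⁹) = A and G + y + 2 y T only has exponents divisible by 3.
-- Hence 4 ∣ RD(N) whenever 3 ∤ N, N ≠ 1 and N - 1 is not a square prime to 3.  For the N of the theorem,
-- N - 1 = p^(2α+1) (12 (pn + i) + p), which is divisible by 3 if p = 3 and of odd p-adic valuation otherwise.
module Submission where

open import Defs
open import Algebra.Bundles using (CommutativeMonoid; CommutativeRing)
open import Data.Bool using (if_then_else_; true; false)
import Data.Integer as ℤ
import Data.Integer.Properties as ℤ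
import Data.Integer.Tactic.RingSolver as ℤSolver
open import Data.List using (map; filter; applyUpTo; upTo)
open import Data.Nat using (ℕ; zero; suc; z≤n; s≤s; _≤_; _<_; _≤?_)
import Data.Nat as ℕ
import Data.Nat.Divisibility as ℕ
open import Data.Nat.Induction using (<-rec)
open import Data.Nat.ListAction using (sum)
open import Data.Nat.Primality using (Prime; euclidsLemma; prime⇒nonZero)
import Data.Nat.Properties as ℕ
open import Data.Nat.Tactic.RingSolver using (solve-∀)
open import Data.Product using (_,_; _×_; ∃; proj₁; proj₂)
open import Data.Sum using (_⊎_; inj₁; inj₂; [_,_]′)
open import Function using (_∘_; id)
open import Level using (Level; 0ℓ)
open import Relation.Binary.PropositionalEquality as ≡ using (_≡_; _≢_)
open import Relation.Nullary using (¬_; yes; no; does; contradiction)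
open import Relation.Nullary.Decidable using (dec-true; dec-false; from-no)
open import Relation.Unary using (Pred; Decidable)

-- Sums and products over initial segments

-- Truncation turns every series and infinite product into a finite expression in a commutative ring
-- where y^K = 0; no limits occur, and a length K may be exchanged for any larger one. The sign y =
-- -q makes each odd factor 1 - q^j of D equal to 1 + y^j, so all theta series involved carry plus
-- signs. As φ is its own inverse modulo 4, 1/D = ψφ, and ψ(y⁹) is the only denominator left. It has
-- constant term 1 and exponents divisible by 9, so dividing by it respects exponents modulo 3. The
-- obstacle in (A + yψ(y⁹))(1 + 2T) is the mixed term 2AT, a product of two unrelated series. It
-- occurs only doubled, so an identity for AT modulo 2 is enough: 2AT = 2yψ(y⁹) merges with yψ(y⁹)
-- into 3yψ(y⁹) = -yψ(y⁹), which is where the correction y + 2yT comes from.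

module BigOperator {c ℓ : Level} (M : CommutativeMonoid c ℓ) where
  open CommutativeMonoid M
  open import Algebra.Properties.CommutativeSemigroup commutativeSemigroup using (interchange)
  open import Relation.Binary.Reasoning.Setoid setoid

  big : ℕ → (ℕ → Carrier) → Carrier
  big zero    f = ε
  big (suc n) f = f 0 ∙ big n (f ∘ suc)

  big-cong : ∀ n {f g} → (∀ i → f i ≈ g i) → big n f ≈ big n g
  big-cong zero    f≈g = refl
  big-cong (suc n) f≈g = ∙-cong (f≈g 0) (big-cong n (f≈g ∘ suc))

  big-ε : ∀ n {f} → (∀ i → f i ≈ ε) → big n f ≈ ε
  big-ε zero    f≈ε = refl
  big-ε (suc n) f≈ε = trans (∙-cong (f≈ε 0) (big-ε n (f≈ε ∘ suc))) (identityˡ ε)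

  big-last : ∀ n f → big (suc n) f ≈ big n f ∙ f n
  big-last zero    f = trans (identityʳ _) (sym (identityˡ _))
  big-last (suc n) f = trans (∙-congˡ (big-last n (f ∘ suc))) (sym (assoc _ _ _))

  big-zip : ∀ n f g → big n (λ i → f i ∙ g i) ≈ big n f ∙ big n g
  big-zip zero    f g = sym (identityˡ ε)
  big-zip (suc n) f g = trans (∙-congˡ (big-zip n (f ∘ suc) (g ∘ suc))) (interchange _ _ _ _)

  big-+ : ∀ m n f → big (m ℕ.+ n) f ≈ big m f ∙ big n (λ i → f (m ℕ.+ i))
  big-+ zero    n f = sym (identityˡ _)
  big-+ (suc m) n f = trans (∙-congˡ (big-+ m n (f ∘ suc))) (sym (assoc _ _ _))

  -- Sorts the indices by residue modulo m; all dissections and all regroupings of products rest on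
  -- it.
  big-blocks : ∀ n m f → big (n ℕ.* m) f ≈ big n (λ i → big m (λ r → f (r ℕ.+ i ℕ.* m)))
  big-blocks zero    m f = refl
  big-blocks (suc n) m f = begin
    big (m ℕ.+ n ℕ.* m) f                                                     ≈⟨ big-+ m (n ℕ.* m) f ⟩
    big m f ∙ big (n ℕ.* m) (λ i → f (m ℕ.+ i))                              ≈⟨ ∙-cong
      (big-cong m λ r → reflexive (≡.cong f (≡.sym (ℕ.+-identityʳ r))))
      (big-blocks n m (λ i → f (m ℕ.+ i))) ⟩
    big m (λ r → f (r ℕ.+ 0)) ∙ big n (λ i → big m (λ r → f (m ℕ.+ (r ℕ.+ i ℕ.* m)))) ≈⟨ ∙-congˡ
      (big-cong n λ i → big-cong m λ r → reflexive (≡.cong f (swap r (i ℕ.* m)))) ⟩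
    big m (λ r → f (r ℕ.+ 0)) ∙ big n (λ i → big m (λ r → f (r ℕ.+ (m ℕ.+ i ℕ.* m)))) ∎
    where
    swap : ∀ r k → m ℕ.+ (r ℕ.+ k) ≡ r ℕ.+ (m ℕ.+ k)
    swap r k = ≡.trans (≡.sym (ℕ.+-assoc m r k))
      (≡.trans (≡.cong (ℕ._+ k) (ℕ.+-comm m r)) (ℕ.+-assoc r m k))

  -- Stands in for convergence: once the entries have become neutral, the length of the sum or
  -- product is immaterial.
  big-stable : ∀ {m n} f → m ≤ n → (∀ i → m ≤ i → f i ≈ ε) → big n f ≈ big m f
  big-stable {m} {n} f m≤n vanish = begin
    big n f                                        ≈⟨ reflexive (≡.cong (λ k → big k f) (≡.sym (ℕ.m+[n∸m]≡n m≤n))) ⟩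
    big (m ℕ.+ (n ℕ.∸ m)) f                        ≈⟨ big-+ m (n ℕ.∸ m) f ⟩
    big m f ∙ big (n ℕ.∸ m) (λ i → f (m ℕ.+ i))    ≈⟨ ∙-congˡ (big-ε (n ℕ.∸ m) λ i → vanish _ (ℕ.m≤m+n m i)) ⟩
    big m f ∙ ε                                    ≈⟨ identityʳ _ ⟩
    big m f                                        ∎

-- The binomial coefficient n(n-1)/2, free of division; `C₂ (suc n)` is the n-th triangular number.
C₂ : ℕ → ℕ
C₂ zero    = 0
C₂ (suc n) = n ℕ.+ C₂ n

-- Nilpotent elements and finite geometric sums

module RingBase {c ℓ : Level} (R : CommutativeRing c ℓ) where
  open CommutativeRing R public hiding (zero)
  open import Algebra.Properties.Semiring.Exp semiring public
  open import Algebra.Properties.CommutativeSemiring.Exp commutativeSemiring public using (^-distrib-*)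
  open import Algebra.Properties.Ring ring public using (-‿distribˡ-*; -‿distribʳ-*; -‿involutive; -0#≈0#)
  open import Algebra.Solver.Ring.NaturalCoefficients.Default commutativeSemiring public
  open import Relation.Binary.Reasoning.Setoid setoid public
  open BigOperator +-commutativeMonoid public hiding (big-+) renaming
    ( big to ∑; big-cong to ∑-cong; big-ε to ∑-0; big-last to ∑-last
    ; big-zip to ∑-zip; big-blocks to ∑-blocks; big-stable to ∑-stable)
  open BigOperator *-commutativeMonoid public hiding (big-+) renaming
    ( big to ∏; big-cong to ∏-cong; big-ε to ∏-1; big-last to ∏-last
    ; big-zip to ∏-zip; big-blocks to ∏-blocks; big-stable to ∏-stable)

  ^-≡ : ∀ x {m n} → m ≡ n → x ^ m ≈ x ^ n
  ^-≡ x e = reflexive (≡.cong (x ^_) e)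

  zero-*ˡ : ∀ {x y} → x ≈ 0# → x * y ≈ 0#
  zero-*ˡ x≈0 = trans (*-congʳ x≈0) (zeroˡ _)

  zero-*ʳ : ∀ {x y} → y ≈ 0# → x * y ≈ 0#
  zero-*ʳ y≈0 = trans (*-congˡ y≈0) (zeroʳ _)

  -- A record rather than the bare equation, so that m and x can be inferred from the type.
  record _Kills_ (m : ℕ) (x : Carrier) : Set ℓ where
    constructor kills
    field
      power≈0 : x ^ m ≈ 0#

  open _Kills_ public

  ^-vanish : ∀ {x m n} → m Kills x → m ≤ n → x ^ n ≈ 0#
  ^-vanish {x} {m} {n} (kills xᵐ≈0) m≤n = begin
    x ^ n                     ≈⟨ ^-≡ x (≡.sym (ℕ.m+[n∸m]≡n m≤n)) ⟩
    x ^ (m ℕ.+ (n ℕ.∸ m))     ≈⟨ ^-homo-* x m (n ℕ.∸ m) ⟩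
    x ^ m * x ^ (n ℕ.∸ m)     ≈⟨ zero-*ˡ xᵐ≈0 ⟩
    0#                        ∎

  kills-mono : ∀ {x m n} → m ≤ n → m Kills x → n Kills x
  kills-mono m≤n m-kills-x = kills (^-vanish m-kills-x m≤n)

  1-cong : ∀ {x y} → x ≈ y → 1# - x ≈ 1# - y
  1-cong x≈y = +-congˡ (-‿cong x≈y)

  1-≈1 : ∀ {x} → x ≈ 0# → 1# - x ≈ 1#
  1-≈1 x≈0 = trans (+-congˡ (trans (-‿cong x≈0) -0#≈0#)) (+-identityʳ 1#)

  1+≈1 : ∀ {x} → x ≈ 0# → 1# + x ≈ 1#
  1+≈1 x≈0 = trans (+-congˡ x≈0) (+-identityʳ 1#)

  complement : ∀ x → (1# - x) + x ≈ 1#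
  complement x = trans (+-assoc _ _ _) (trans (+-congˡ (-‿inverseˡ x)) (+-identityʳ 1#))

  ∑-*ˡ : ∀ n x f → ∑ n (λ i → x * f i) ≈ x * ∑ n f
  ∑-*ˡ zero    x f = sym (zeroʳ x)
  ∑-*ˡ (suc n) x f = trans (+-congˡ (∑-*ˡ n x (f ∘ suc))) (sym (distribˡ x _ _))

  ∑-shift : ∀ n f → f n ≈ 0# → ∑ n f ≈ f 0 + ∑ n (f ∘ suc)
  ∑-shift n f fn≈0 = begin
    ∑ n f               ≈⟨ +-identityʳ _ ⟨
    ∑ n f + 0#          ≈⟨ +-congˡ fn≈0 ⟨
    ∑ n f + f n         ≈⟨ ∑-last n f ⟨
    f 0 + ∑ n (f ∘ suc) ∎

  -- The remainder x^n stays on the left, so that the induction step is an identity with natural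
  -- coefficients in which `1# - x` is an atom.
  geometric : ∀ n x → (1# - x) * ∑ n (x ^_) + x ^ n ≈ 1#
  geometric zero    x = trans (+-congʳ (zeroʳ _)) (+-identityˡ 1#)
  geometric (suc n) x = begin
    (1# - x) * (1# + ∑ n (λ i → x * x ^ i)) + x * x ^ n        ≈⟨ +-congʳ (*-congˡ (+-congˡ (∑-*ˡ n x (x ^_)))) ⟩
    (1# - x) * (1# + x * ∑ n (x ^_)) + x * x ^ n               ≈⟨ solve 4 (λ d x s u →
      d :* (con 1 :+ x :* s) :+ x :* u := d :+ x :* (d :* s :+ u)) refl (1# - x) x _ _ ⟩
    (1# - x) + x * ((1# - x) * ∑ n (x ^_) + x ^ n)             ≈⟨ +-congˡ (trans (*-congˡ (geometric n x)) (*-identityʳ x)) ⟩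
    (1# - x) + x                                               ≈⟨ complement x ⟩
    1#                                                         ∎

  geometric-quotient : ∀ n x → ∑ n (x ^_) * (1# - x) ≈ 1# - x ^ n
  geometric-quotient n x = begin
    ∑ n (x ^_) * (1# - x)                     ≈⟨ *-comm _ _ ⟩
    (1# - x) * ∑ n (x ^_)                     ≈⟨ +-identityʳ _ ⟨
    (1# - x) * ∑ n (x ^_) + 0#                ≈⟨ +-congˡ (-‿inverseʳ (x ^ n)) ⟨
    (1# - x) * ∑ n (x ^_) + (x ^ n - x ^ n)   ≈⟨ +-assoc _ _ _ ⟨
    (1# - x) * ∑ n (x ^_) + x ^ n - x ^ n     ≈⟨ +-congʳ (geometric n x) ⟩
    1# - x ^ n                                ∎

-- The Jacobi triple product for nilpotent a and b

module TripleProduct {c ℓ : Level} (R : CommutativeRing c ℓ) where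
  open RingBase R

  term : Carrier → Carrier → ℕ → Carrier
  term Q x i = x ^ i * Q ^ C₂ i

  term-suc : ∀ Q x i → term Q x (suc i) ≈ x * Q ^ i * term Q x i
  term-suc Q x i = begin
    x * x ^ i * Q ^ (i ℕ.+ C₂ i)      ≈⟨ *-congˡ (^-homo-* Q i (C₂ i)) ⟩
    x * x ^ i * (Q ^ i * Q ^ C₂ i)    ≈⟨ solve 4 (λ x u v w → x :* u :* (v :* w) := x :* v :* (u :* w)) refl x (x ^ i) (Q ^ i) (Q ^ C₂ i) ⟩
    x * Q ^ i * (x ^ i * Q ^ C₂ i)    ∎

  term-cong : ∀ Q {x y} i → x ≈ y → term Q x i ≈ term Q y i
  term-cong Q i x≈y = *-congʳ (^-congˡ i x≈y)

  term-*Q : ∀ Q x i → term Q (x * Q) i ≈ Q ^ i * term Q x i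
  term-*Q Q x i = begin
    (x * Q) ^ i * Q ^ C₂ i       ≈⟨ *-congʳ (^-distrib-* x Q i) ⟩
    x ^ i * Q ^ i * Q ^ C₂ i     ≈⟨ solve 3 (λ u v w → u :* v :* w := v :* (u :* w)) refl (x ^ i) (Q ^ i) (Q ^ C₂ i) ⟩
    Q ^ i * (x ^ i * Q ^ C₂ i)   ∎

  module Tail (Q : Carrier) (K : ℕ) (K-kills-Q : K Kills Q) where

    -- The product (Q^(i+1); Q)_∞, which plays the part of (Q; Q)_∞ / (Q; Q)ᵢ. It has K factors for
    -- every i, since those of exponent at least K equal 1.
    E : ℕ → Carrier
    E i = ∏ K (λ k → 1# - Q ^ suc (i ℕ.+ k))

    E-suc : ∀ i → E i ≈ (1# - Q ^ suc i) * E (suc i)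
    E-suc i = begin
      E i                                                      ≈⟨ *-identityʳ _ ⟨
      -- The factor inserted here equals 1; it lets the window of K factors slide by one.
      E i * 1#                                                 ≈⟨ *-congˡ (1-≈1 (^-vanish K-kills-Q (ℕ.m≤n⇒m≤1+n (ℕ.m≤n+m K i)))) ⟨
      E i * (1# - Q ^ suc (i ℕ.+ K))                           ≈⟨ ∏-last K (λ k → 1# - Q ^ suc (i ℕ.+ k)) ⟨
      (1# - Q ^ suc (i ℕ.+ 0)) * ∏ K (λ k → 1# - Q ^ suc (i ℕ.+ suc k)) ≈⟨ *-cong
        (+-congˡ (-‿cong (^-≡ Q (≡.cong suc (ℕ.+-identityʳ i)))))
        (∏-cong K λ k → +-congˡ (-‿cong (^-≡ Q (≡.cong suc (ℕ.+-suc i k))))) ⟩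
      (1# - Q ^ suc i) * E (suc i)                             ∎

    E-step : ∀ i → E i + Q ^ suc i * E (suc i) ≈ E (suc i)
    E-step i = begin
      E i + Q ^ suc i * E (suc i)                                 ≈⟨ +-congʳ (E-suc i) ⟩
      (1# - Q ^ suc i) * E (suc i) + Q ^ suc i * E (suc i)        ≈⟨ distribʳ _ _ _ ⟨
      (1# - Q ^ suc i + Q ^ suc i) * E (suc i)                    ≈⟨ *-congʳ (complement _) ⟩
      1# * E (suc i)                                              ≈⟨ *-identityˡ _ ⟩
      E (suc i)                                                   ∎

    E-stable : ∀ {i} → K ≤ i → E i ≈ 1#
    E-stable {i} K≤i = ∏-1 K λ k → 1-≈1 (^-vanish K-kills-Q (ℕ.m≤n⇒m≤1+n (ℕ.≤-trans K≤i (ℕ.m≤m+n i k))))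

    -- Euler's series Σ xⁱ Q^(i(i-1)/2) / (Q; Q)ᵢ, multiplied by E 0 = (Q; Q)_∞ to clear denominators.
    euler : Carrier → Carrier
    euler x = ∑ K (λ i → term Q x i * E i)

    -- The functional equation F(x) = (1 + x) F(xQ). On the right, `term Q x (suc i)` arises from
    -- index i + 1 of F(xQ) and from x times index i, with factors that `E-step` adds up to
    -- `E (suc i)`.
    euler-step : ∀ x → x ^ K ≈ 0# → euler x ≈ (1# + x) * euler (x * Q)
    euler-step x xᴷ≈0 = sym (begin
      (1# + x) * euler (x * Q)
        ≈⟨ trans (distribʳ _ _ _) (+-congʳ (*-identityˡ _)) ⟩
      euler (x * Q) + x * euler (x * Q)
        ≈⟨ +-cong (∑-shift K _ (zero-*ˡ (trans (term-*Q Q x K) (zero-*ʳ (zero-*ˡ xᴷ≈0))))) (sym (∑-*ˡ K x _)) ⟩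
      (1# * 1# * E 0 + ∑ K (λ i → term Q (x * Q) (suc i) * E (suc i))) + ∑ K (λ i → x * (term Q (x * Q) i * E i))
        ≈⟨ +-assoc _ _ _ ⟩
      1# * 1# * E 0 + (∑ K (λ i → term Q (x * Q) (suc i) * E (suc i)) + ∑ K (λ i → x * (term Q (x * Q) i * E i)))
        ≈⟨ +-congˡ (sym (∑-zip K _ _)) ⟩
      1# * 1# * E 0 + ∑ K (λ i → term Q (x * Q) (suc i) * E (suc i) + x * (term Q (x * Q) i * E i))
        ≈⟨ +-congˡ (∑-cong K step) ⟩
      1# * 1# * E 0 + ∑ K (λ i → term Q x (suc i) * E (suc i))
        ≈⟨ ∑-shift K _ (zero-*ˡ (zero-*ˡ xᴷ≈0)) ⟨
      euler x ∎)
      where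
      step : ∀ i → term Q (x * Q) (suc i) * E (suc i) + x * (term Q (x * Q) i * E i) ≈ term Q x (suc i) * E (suc i)
      step i = begin
        term Q (x * Q) (suc i) * E (suc i) + x * (term Q (x * Q) i * E i)
          ≈⟨ +-cong (*-congʳ (trans (term-*Q Q x (suc i)) (*-congˡ (term-suc Q x i)))) (*-congˡ (*-congʳ (term-*Q Q x i))) ⟩
        Q ^ suc i * (x * Q ^ i * term Q x i) * E (suc i) + x * (Q ^ i * term Q x i * E i)
          ≈⟨ solve 6 (λ q x u t e e′ → q :* (x :* u :* t) :* e′ :+ x :* (u :* t :* e) := x :* u :* t :* (e :+ q :* e′)) refl
               (Q ^ suc i) x (Q ^ i) (term Q x i) (E i) (E (suc i)) ⟩
        x * Q ^ i * term Q x i * (E i + Q ^ suc i * E (suc i))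
          ≈⟨ *-cong (sym (term-suc Q x i)) (E-step i) ⟩
        term Q x (suc i) * E (suc i) ∎

    euler-cong : ∀ {x y} → x ≈ y → euler x ≈ euler y
    euler-cong x≈y = ∑-cong K λ i → *-congʳ (term-cong Q i x≈y)

    euler-iterate : ∀ m x → x ^ K ≈ 0# → euler x ≈ ∏ m (λ k → 1# + x * Q ^ k) * euler (x * Q ^ m)
    euler-iterate zero    x xᴷ≈0 = trans (euler-cong (sym (*-identityʳ x))) (sym (*-identityˡ _))
    euler-iterate (suc m) x xᴷ≈0 = begin
      euler x                                                                     ≈⟨ euler-step x xᴷ≈0 ⟩
      (1# + x) * euler (x * Q)                                                    ≈⟨ *-cong (+-congˡ (sym (*-identityʳ x)))
        (euler-iterate m (x * Q) (trans (^-distrib-* x Q K) (zero-*ˡ xᴷ≈0))) ⟩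
      (1# + x * 1#) * (∏ m (λ k → 1# + x * Q * Q ^ k) * euler (x * Q * Q ^ m))    ≈⟨ *-assoc _ _ _ ⟨
      (1# + x * 1#) * ∏ m (λ k → 1# + x * Q * Q ^ k) * euler (x * Q * Q ^ m)      ≈⟨ *-cong
        (*-congˡ (∏-cong m λ k → +-congˡ (*-assoc _ _ _))) (euler-cong (*-assoc _ _ _)) ⟩
      ∏ (suc m) (λ k → 1# + x * Q ^ k) * euler (x * Q ^ suc m)                    ∎

    euler-0 : ∀ x → x ≈ 0# → x ^ K ≈ 0# → euler x ≈ E 0
    euler-0 x x≈0 xᴷ≈0 = begin
      euler x                                                       ≈⟨ ∑-shift K _ (zero-*ˡ (zero-*ˡ xᴷ≈0)) ⟩
      1# * 1# * E 0 + ∑ K (λ i → term Q x (suc i) * E (suc i))       ≈⟨ +-cong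
        (trans (*-congʳ (*-identityˡ 1#)) (*-identityˡ _)) (∑-0 K λ i → zero-*ˡ (zero-*ˡ (zero-*ˡ x≈0))) ⟩
      E 0 + 0#                                                      ≈⟨ +-identityʳ _ ⟩
      E 0                                                           ∎

    -- K applications of the functional equation bring the argument to x Q^K = 0, where only the
    -- constant term `E 0` survives.
    euler-product : ∀ x → x ^ K ≈ 0# → euler x ≈ ∏ K (λ k → 1# + x * Q ^ k) * E 0
    euler-product x xᴷ≈0 = trans (euler-iterate K x xᴷ≈0)
      (*-congˡ (euler-0 _ (zero-*ʳ (power≈0 K-kills-Q)) (trans (^-distrib-* x (Q ^ K) K) (zero-*ˡ xᴷ≈0))))

  -- Ramanujan's f(a, b), with the summands at j = i and j = -(i + 1) taken together.
  θ : ℕ → Carrier → Carrier → Carrier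
  θ K a b = ∑ K (λ i → term (a * b) a i + term (a * b) b (suc i))

  module _ (a b : Carrier) (K : ℕ) (K-kills-a : K Kills a) (K-kills-b : K Kills b) where
    private
      Q : Carrier
      Q = a * b

      K-kills-Q : K Kills Q
      K-kills-Q = kills (trans (^-distrib-* a b K) (zero-*ˡ (power≈0 K-kills-a)))

      Q-vanish : ∀ {n} → K ≤ n → Q ^ n ≈ 0#
      Q-vanish = ^-vanish K-kills-Q

      open Tail Q K K-kills-Q

      -- C n i is the summand a^(j(j+1)/2) b^(j(j-1)/2) of the bilateral series at j = i - n.
      C : ℕ → ℕ → Carrier
      C zero    i       = term Q a i
      C (suc n) zero    = b * Q ^ n * C n zero
      C (suc n) (suc i) = C n i

      -- The bilateral summands at j and j - 1 have ratio a^j b^(j-1) = Q^j / b; here j = i - n, and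
      -- the equation is cleared of negative powers.
      C-step : ∀ n i → Q ^ i * C (suc n) i ≈ b * Q ^ n * C n i
      C-step n       zero    = *-identityˡ _
      C-step zero    (suc i) = begin
        a * b * Q ^ i * term Q a i            ≈⟨ solve 4 (λ a b u t → a :* b :* u :* t := b :* con 1 :* (a :* u :* t)) refl a b (Q ^ i) (term Q a i) ⟩
        b * 1# * (a * Q ^ i * term Q a i)     ≈⟨ *-congˡ (term-suc Q a i) ⟨
        b * 1# * term Q a (suc i)             ∎
      C-step (suc n) (suc i) = begin
        Q * Q ^ i * C (suc n) i               ≈⟨ *-assoc _ _ _ ⟩
        Q * (Q ^ i * C (suc n) i)             ≈⟨ *-congˡ (C-step n i) ⟩
        Q * (b * Q ^ n * C n i)               ≈⟨ solve 4 (λ q b u t → q :* (b :* u :* t) := b :* (q :* u) :* t) refl Q b (Q ^ n) (C n i) ⟩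
        b * (Q * Q ^ n) * C n i               ∎

      C-0 : ∀ n → C n 0 ≈ term Q b n
      C-0 zero    = refl
      C-0 (suc n) = trans (*-congˡ (C-0 n)) (sym (term-suc Q b n))

      C-vanish : ∀ n i → i ℕ.+ K ≤ n → C n i ≈ 0#
      C-vanish n       zero    K≤n       = trans (C-0 n) (zero-*ˡ (^-vanish K-kills-b K≤n))
      C-vanish (suc n) (suc i) (s≤s i+K≤n) = C-vanish n i i+K≤n

      -- In T-step, C-step turns multiplication by 1 + b Qⁿ into a telescoping sum that shifts the origin of C by one.
      T : ℕ → Carrier
      T n = ∑ (n ℕ.+ K) (λ i → C n i * E i)

      T-step : ∀ n → T (suc n) ≈ (1# + b * Q ^ n) * T n
      T-step n = sym (begin
        (1# + b * Q ^ n) * T n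
          ≈⟨ trans (distribʳ _ _ _) (+-cong (*-identityˡ _) (sym (∑-*ˡ M _ _))) ⟩
        T n + ∑ M (λ i → b * Q ^ n * (C n i * E i))
          ≈⟨ +-congˡ (∑-cong M λ i → trans (sym (*-assoc _ _ _)) (*-congʳ (sym (C-step n i)))) ⟩
        T n + ∑ M (λ i → Q ^ i * C (suc n) i * E i)
          ≈⟨ +-congˡ (∑-shift M _ (zero-*ˡ (zero-*ˡ (Q-vanish (ℕ.m≤n+m K n))))) ⟩
        T n + (1# * C (suc n) 0 * E 0 + ∑ M (λ i → Q ^ suc i * C n i * E (suc i)))
          ≈⟨ solve 3 (λ t u v → t :+ (u :+ v) := u :+ (t :+ v)) refl _ _ _ ⟩
        1# * C (suc n) 0 * E 0 + (T n + ∑ M (λ i → Q ^ suc i * C n i * E (suc i)))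
          ≈⟨ +-cong (*-congʳ (*-identityˡ _)) (trans (sym (∑-zip M _ _)) (∑-cong M step)) ⟩
        C (suc n) 0 * E 0 + ∑ M (λ i → C n i * E (suc i)) ∎)
        where
        M : ℕ
        M = n ℕ.+ K
        step : ∀ i → C n i * E i + Q ^ suc i * C n i * E (suc i) ≈ C n i * E (suc i)
        step i = begin
          C n i * E i + Q ^ suc i * C n i * E (suc i)
            ≈⟨ solve 4 (λ c e q e′ → c :* e :+ q :* c :* e′ := c :* (e :+ q :* e′)) refl (C n i) (E i) (Q ^ suc i) (E (suc i)) ⟩
          C n i * (E i + Q ^ suc i * E (suc i)) ≈⟨ *-congˡ (E-step i) ⟩
          C n i * E (suc i) ∎

      T-product : ∀ n → T n ≈ ∏ n (λ k → 1# + b * Q ^ k) * euler a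
      T-product zero    = sym (*-identityˡ _)
      T-product (suc n) = begin
        T (suc n)                                                 ≈⟨ T-step n ⟩
        (1# + b * Q ^ n) * T n                                    ≈⟨ *-congˡ (T-product n) ⟩
        (1# + b * Q ^ n) * (∏ n (λ k → 1# + b * Q ^ k) * euler a) ≈⟨ solve 3 (λ x p e → x :* (p :* e) := p :* x :* e) refl _ _ _ ⟩
        ∏ n (λ k → 1# + b * Q ^ k) * (1# + b * Q ^ n) * euler a   ≈⟨ *-congʳ (∏-last n _) ⟨
        ∏ (suc n) (λ k → 1# + b * Q ^ k) * euler a                ∎

      C-sum : ∀ n → ∑ (n ℕ.+ K) (C n) ≈ ∑ n (λ l → C (suc l) 0) + ∑ K (term Q a)
      C-sum zero    = sym (+-identityˡ _)
      C-sum (suc n) = begin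
        C (suc n) 0 + ∑ (n ℕ.+ K) (C n)                             ≈⟨ +-congˡ (C-sum n) ⟩
        C (suc n) 0 + (∑ n (λ l → C (suc l) 0) + ∑ K (term Q a))    ≈⟨ solve 3 (λ x p e → x :+ (p :+ e) := p :+ x :+ e) refl _ _ _ ⟩
        ∑ n (λ l → C (suc l) 0) + C (suc n) 0 + ∑ K (term Q a)      ≈⟨ +-congʳ (∑-last n _) ⟨
        ∑ (suc n) (λ l → C (suc l) 0) + ∑ K (term Q a)              ∎

      -- The origin is moved by 2K so that the factors `E i` drop out: for i ≥ K they equal 1, and
      -- for i ≤ K the summand has index i - 2K ≤ -K and vanishes because it contains b^K.
      T≈θ : T (K ℕ.+ K) ≈ θ K a b
      T≈θ = begin
        ∑ (K ℕ.+ K ℕ.+ K) (λ i → C (K ℕ.+ K) i * E i)               ≈⟨ ∑-cong (K ℕ.+ K ℕ.+ K) drop-E ⟩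
        ∑ (K ℕ.+ K ℕ.+ K) (C (K ℕ.+ K))                             ≈⟨ C-sum (K ℕ.+ K) ⟩
        ∑ (K ℕ.+ K) (λ l → C (suc l) 0) + ∑ K (term Q a)            ≈⟨ +-congʳ (∑-stable _ (ℕ.m≤m+n K K)
          λ i K≤i → C-vanish (suc i) 0 (ℕ.m≤n⇒m≤1+n K≤i)) ⟩
        ∑ K (λ l → C (suc l) 0) + ∑ K (term Q a)                    ≈⟨ +-congʳ (∑-cong K λ l → C-0 (suc l)) ⟩
        ∑ K (λ l → term Q b (suc l)) + ∑ K (term Q a)               ≈⟨ +-comm _ _ ⟩
        ∑ K (term Q a) + ∑ K (λ l → term Q b (suc l))               ≈⟨ ∑-zip K _ _ ⟨
        θ K a b                                                     ∎
        where
        drop-E : ∀ i → C (K ℕ.+ K) i * E i ≈ C (K ℕ.+ K) i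
        drop-E i with ℕ.≤-total K i
        ... | inj₁ K≤i = trans (*-congˡ (E-stable K≤i)) (*-identityʳ _)
        ... | inj₂ i≤K = trans (zero-*ˡ z) (sym z)
          where
          z : C (K ℕ.+ K) i ≈ 0#
          z = C-vanish (K ℕ.+ K) i (ℕ.+-monoˡ-≤ K i≤K)

    triple-product : θ K a b ≈ ∏ K (λ k → (1# + a * Q ^ k) * ((1# + b * Q ^ k) * (1# - Q ^ suc k)))
    triple-product = begin
      θ K a b                                                           ≈⟨ T≈θ ⟨
      T (K ℕ.+ K)                                                       ≈⟨ T-product (K ℕ.+ K) ⟩
      ∏ (K ℕ.+ K) (λ k → 1# + b * Q ^ k) * euler a                      ≈⟨ *-cong
        (∏-stable _ (ℕ.m≤m+n K K) λ i K≤i → 1+≈1 (zero-*ʳ (Q-vanish K≤i))) (euler-product a (power≈0 K-kills-a)) ⟩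
      ∏ K (λ k → 1# + b * Q ^ k) * (∏ K (λ k → 1# + a * Q ^ k) * E 0)   ≈⟨ solve 3 (λ x p e → x :* (p :* e) := p :* (x :* e)) refl _ _ _ ⟩
      ∏ K (λ k → 1# + a * Q ^ k) * (∏ K (λ k → 1# + b * Q ^ k) * E 0)   ≈⟨ *-congˡ (∏-zip K _ _) ⟨
      ∏ K (λ k → 1# + a * Q ^ k) * ∏ K (λ k → (1# + b * Q ^ k) * (1# - Q ^ suc k)) ≈⟨ ∏-zip K _ _ ⟨
      ∏ K (λ k → (1# + a * Q ^ k) * ((1# + b * Q ^ k) * (1# - Q ^ suc k))) ∎

-- Theta series modulo 2 and 4

C₂-+ : ∀ m n → C₂ (m ℕ.+ n) ≡ C₂ m ℕ.+ C₂ n ℕ.+ m ℕ.* n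
C₂-+ zero    n = ≡.sym (ℕ.+-identityʳ (C₂ n))
C₂-+ (suc m) n = ≡.trans (≡.cong (m ℕ.+ n ℕ.+_) (C₂-+ m n)) (rearrange m n (C₂ m) (C₂ n))
  where
  rearrange : ∀ m n u v → m ℕ.+ n ℕ.+ (u ℕ.+ v ℕ.+ m ℕ.* n) ≡ m ℕ.+ u ℕ.+ v ℕ.+ (n ℕ.+ m ℕ.* n)
  rearrange = solve-∀

-- Brings triangular numbers along an arithmetic progression into the shape r i + (r + s) C₂(i) of
-- the exponents of f(yʳ, yˢ).
C₂-progression : ∀ m i → C₂ (suc (i ℕ.* m)) ≡ C₂ (suc m) ℕ.* i ℕ.+ m ℕ.* m ℕ.* C₂ i
C₂-progression m zero    = ≡.sym (≡.cong₂ ℕ._+_ (ℕ.*-zeroʳ (C₂ (suc m))) (ℕ.*-zeroʳ (m ℕ.* m)))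
C₂-progression m (suc i) = begin
  C₂ (suc (m ℕ.+ i ℕ.* m))                                        ≡⟨ ≡.cong C₂ (≡.sym (ℕ.+-suc m (i ℕ.* m))) ⟩
  C₂ (m ℕ.+ suc (i ℕ.* m))                                        ≡⟨ C₂-+ m (suc (i ℕ.* m)) ⟩
  C₂ m ℕ.+ C₂ (suc (i ℕ.* m)) ℕ.+ m ℕ.* suc (i ℕ.* m)             ≡⟨ ≡.cong (λ e → C₂ m ℕ.+ e ℕ.+ m ℕ.* suc (i ℕ.* m)) (C₂-progression m i) ⟩
  C₂ m ℕ.+ ((m ℕ.+ C₂ m) ℕ.* i ℕ.+ m ℕ.* m ℕ.* C₂ i) ℕ.+ m ℕ.* suc (i ℕ.* m) ≡⟨ rearrange m i (C₂ m) (C₂ i) ⟩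
  (m ℕ.+ C₂ m) ℕ.* suc i ℕ.+ m ℕ.* m ℕ.* (i ℕ.+ C₂ i)             ∎
  where
  open ≡.≡-Reasoning
  rearrange : ∀ m i u v → u ℕ.+ ((m ℕ.+ u) ℕ.* i ℕ.+ m ℕ.* m ℕ.* v) ℕ.+ m ℕ.* suc (i ℕ.* m)
                        ≡ (m ℕ.+ u) ℕ.* suc i ℕ.+ m ℕ.* m ℕ.* (i ℕ.+ v)
  rearrange = solve-∀

-- The factor 1 is kept to match the exponents of `Θ` with r = s = 1.
C₂-square : ∀ i → i ℕ.* i ≡ 1 ℕ.* i ℕ.+ 2 ℕ.* C₂ i
C₂-square zero    = ≡.refl
C₂-square (suc i) = ≡.trans (≡.cong (λ e → suc (i ℕ.+ e)) (≡.trans (ℕ.*-suc i i) (≡.cong (i ℕ.+_) (C₂-square i))))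
  (rearrange i (C₂ i))
  where
  rearrange : ∀ i u → suc (i ℕ.+ (i ℕ.+ (1 ℕ.* i ℕ.+ 2 ℕ.* u))) ≡ 1 ℕ.* suc i ℕ.+ 2 ℕ.* (i ℕ.+ u)
  rearrange = solve-∀

i≤C₂[1+i] : ∀ i → i ≤ C₂ (suc i)
i≤C₂[1+i] i = ℕ.m≤m+n i (C₂ i)

module ThetaSeries {c ℓ : Level} (R : CommutativeRing c ℓ) where
  open RingBase R
  open TripleProduct R

  -- φ = 1 + 2S; A collects the exponents of ψ divisible by 3, and T those of S prime to 3.
  ψ φ S T A : ℕ → Carrier → Carrier
  ψ K y = ∑ K (λ n → y ^ C₂ (suc n))
  φ K y = ∑ K (λ i → y ^ (i ℕ.* i) + y ^ (suc i ℕ.* suc i))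
  S K y = ∑ K (λ i → y ^ (suc i ℕ.* suc i))
  T K y = ∑ K (λ i → y ^ ((1 ℕ.+ i ℕ.* 3) ℕ.* (1 ℕ.+ i ℕ.* 3)) + y ^ ((2 ℕ.+ i ℕ.* 3) ℕ.* (2 ℕ.+ i ℕ.* 3)))
  A K y = ∑ K (λ i → y ^ C₂ (1 ℕ.+ i ℕ.* 3) + y ^ C₂ (3 ℕ.+ i ℕ.* 3))

  -- Ramanujan's f(yʳ, yˢ) with its exponents multiplied out.
  Θ : ℕ → Carrier → ℕ → ℕ → Carrier
  Θ K y r s = ∑ K (λ i → y ^ (r ℕ.* i ℕ.+ (r ℕ.+ s) ℕ.* C₂ i) + y ^ (s ℕ.* suc i ℕ.+ (r ℕ.+ s) ℕ.* C₂ (suc i)))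

  -- f₁/f₄ in blocks of four exponents; the trailing `1#` replaces the factor whose exponent is
  -- divisible by 4.
  D : ℕ → Carrier → Carrier
  D K x = ∏ K (λ k → (1# - x ^ (1 ℕ.+ k ℕ.* 4)) * ((1# - x ^ (2 ℕ.+ k ℕ.* 4)) * ((1# - x ^ (3 ℕ.+ k ℕ.* 4)) * 1#)))

  ^-kills : ∀ {y K} m → K Kills y → K Kills (y ^ suc m)
  ^-kills {y} {K} m yᴷ≈0 = kills (trans (^-assocʳ y (suc m) K) (^-vanish yᴷ≈0 (ℕ.m≤n*m K (suc m))))

  zero-+ : ∀ {x z} → x ≈ 0# → z ≈ 0# → x + z ≈ 0#
  zero-+ x≈0 z≈0 = trans (+-cong x≈0 z≈0) (+-identityʳ 0#)

  ψ-stable : ∀ {K M y} → K Kills y → K ≤ M → ψ M y ≈ ψ K y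
  ψ-stable {K} {M} {y} yᴷ≈0 K≤M = ∑-stable _ K≤M λ i K≤i → ^-vanish yᴷ≈0 (ℕ.≤-trans K≤i (i≤C₂[1+i] i))

  S-stable : ∀ {K M y} → K Kills y → K ≤ M → S M y ≈ S K y
  S-stable {K} {M} {y} yᴷ≈0 K≤M = ∑-stable _ K≤M λ i K≤i →
    ^-vanish yᴷ≈0 (ℕ.≤-trans (ℕ.m≤n⇒m≤1+n K≤i) (ℕ.m≤m*n (suc i) (suc i)))

  φ-stable : ∀ {K M y} → K Kills y → K ≤ M → φ M y ≈ φ K y
  φ-stable {K} {M} {y} yᴷ≈0 K≤M = ∑-stable _ K≤M λ i K≤i → zero-+
    (^-vanish yᴷ≈0 (ℕ.≤-trans K≤i (m≤m² i)))
    (^-vanish yᴷ≈0 (ℕ.≤-trans (ℕ.m≤n⇒m≤1+n K≤i) (m≤m² (suc i))))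
    where
    m≤m² : ∀ m → m ≤ m ℕ.* m
    m≤m² zero    = z≤n
    m≤m² (suc m) = ℕ.m≤m*n (suc m) (suc m)

  Θ-stable : ∀ {K M y} r s → K Kills y → K ≤ M → Θ M y (suc r) (suc s) ≈ Θ K y (suc r) (suc s)
  Θ-stable {K} {M} {y} r s yᴷ≈0 K≤M = ∑-stable _ K≤M λ i K≤i → zero-+
    (^-vanish yᴷ≈0 (ℕ.≤-trans K≤i (ℕ.≤-trans (ℕ.m≤n*m i (suc r)) (ℕ.m≤m+n _ _))))
    (^-vanish yᴷ≈0 (ℕ.≤-trans (ℕ.m≤n⇒m≤1+n K≤i) (ℕ.≤-trans (ℕ.m≤n*m (suc i) (suc s)) (ℕ.m≤m+n _ _))))

  -- Both exponents are successors, which makes yʳ and yˢ nilpotent as the triple product requires.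
  Θ-product : ∀ {K y} r s → K Kills y → Θ K y (suc r) (suc s) ≈
    ∏ K (λ k → (1# + y ^ (suc r ℕ.+ k ℕ.* (suc r ℕ.+ suc s)))
             * ((1# + y ^ (suc s ℕ.+ k ℕ.* (suc r ℕ.+ suc s))) * (1# - y ^ (suc k ℕ.* (suc r ℕ.+ suc s)))))
  Θ-product {K} {y} r s yᴷ≈0 = begin
    Θ K y (suc r) (suc s)
      ≈⟨ ∑-cong K (λ i → +-cong (term-^ (suc r) i) (term-^ (suc s) (suc i))) ⟨
    θ K a b
      ≈⟨ triple-product a b K (^-kills r yᴷ≈0) (^-kills s yᴷ≈0) ⟩
    ∏ K (λ k → (1# + a * (a * b) ^ k) * ((1# + b * (a * b) ^ k) * (1# - (a * b) ^ suc k)))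
      ≈⟨ ∏-cong K (λ k → *-cong (+-congˡ (shifted (suc r) k)) (*-cong (+-congˡ (shifted (suc s) k)) (+-congˡ (-‿cong (Q^ (suc k)))))) ⟩
    ∏ K (λ k → (1# + y ^ (suc r ℕ.+ k ℕ.* m)) * ((1# + y ^ (suc s ℕ.+ k ℕ.* m)) * (1# - y ^ (suc k ℕ.* m)))) ∎
    where
    a = y ^ suc r
    b = y ^ suc s
    m = suc r ℕ.+ suc s
    Q^ : ∀ n → (a * b) ^ n ≈ y ^ (n ℕ.* m)
    Q^ n = begin
      (a * b) ^ n       ≈⟨ ^-congˡ n (^-homo-* y (suc r) (suc s)) ⟨
      (y ^ m) ^ n       ≈⟨ ^-assocʳ y m n ⟩
      y ^ (m ℕ.* n)     ≈⟨ ^-≡ y (ℕ.*-comm m n) ⟩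
      y ^ (n ℕ.* m)     ∎
    shifted : ∀ t k → y ^ t * (a * b) ^ k ≈ y ^ (t ℕ.+ k ℕ.* m)
    shifted t k = trans (*-congˡ (Q^ k)) (sym (^-homo-* y t (k ℕ.* m)))
    term-^ : ∀ t i → term (a * b) (y ^ t) i ≈ y ^ (t ℕ.* i ℕ.+ m ℕ.* C₂ i)
    term-^ t i = begin
      (y ^ t) ^ i * (a * b) ^ C₂ i           ≈⟨ *-cong (^-assocʳ y t i) (trans (Q^ (C₂ i)) (^-≡ y (ℕ.*-comm (C₂ i) m))) ⟩
      y ^ (t ℕ.* i) * y ^ (m ℕ.* C₂ i)       ≈⟨ ^-homo-* y (t ℕ.* i) (m ℕ.* C₂ i) ⟨
      y ^ (t ℕ.* i ℕ.+ m ℕ.* C₂ i)           ∎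

  -- ψ(y) = f(y³, y): triangular numbers of even and of odd index are the exponents at j ≥ 0 and at
  -- j < 0.
  ψ≈Θ : ∀ {K y} → K Kills y → ψ K y ≈ Θ K y 3 1
  ψ≈Θ {K} {y} yᴷ≈0 = begin
    ψ K y                                                              ≈⟨ ψ-stable yᴷ≈0 (ℕ.m≤m*n K 2) ⟨
    ψ (K ℕ.* 2) y                                                      ≈⟨ ∑-blocks K 2 _ ⟩
    ∑ K (λ i → y ^ C₂ (1 ℕ.+ i ℕ.* 2) + (y ^ C₂ (2 ℕ.+ i ℕ.* 2) + 0#)) ≈⟨ ∑-cong K (λ i → +-cong
      (^-≡ y (C₂-progression 2 i))
      (trans (+-identityʳ _) (^-≡ y (≡.trans (≡.cong (1 ℕ.+ i ℕ.* 2 ℕ.+_) (C₂-progression 2 i)) (rearrange i (C₂ i)))))) ⟩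
    Θ K y 3 1                                                          ∎
    where
    rearrange : ∀ i u → 1 ℕ.+ i ℕ.* 2 ℕ.+ (3 ℕ.* i ℕ.+ 4 ℕ.* u) ≡ 1 ℕ.* suc i ℕ.+ 4 ℕ.* (i ℕ.+ u)
    rearrange = solve-∀

  φ≈Θ : ∀ K y → φ K y ≈ Θ K y 1 1
  φ≈Θ K y = ∑-cong K λ i → +-cong (^-≡ y (C₂-square i)) (^-≡ y (C₂-square (suc i)))

  A≈Θ : ∀ K y → A K y ≈ Θ K (y ^ 3) 2 1
  A≈Θ K y = ∑-cong K λ i → +-cong
    (trans (^-≡ y (≡.trans (C₂-progression 3 i) (rearrange₁ i (C₂ i)))) (sym (^-assocʳ y 3 (2 ℕ.* i ℕ.+ 3 ℕ.* C₂ i))))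
    (trans (^-≡ y (≡.trans (≡.cong (λ e → 2 ℕ.+ i ℕ.* 3 ℕ.+ (1 ℕ.+ i ℕ.* 3 ℕ.+ e)) (C₂-progression 3 i)) (rearrange₂ i (C₂ i)))) (sym (^-assocʳ y 3 (1 ℕ.* suc i ℕ.+ 3 ℕ.* C₂ (suc i)))))
    where
    rearrange₁ : ∀ i u → 6 ℕ.* i ℕ.+ 9 ℕ.* u ≡ 3 ℕ.* (2 ℕ.* i ℕ.+ 3 ℕ.* u)
    rearrange₁ = solve-∀
    rearrange₂ : ∀ i u → 2 ℕ.+ i ℕ.* 3 ℕ.+ (1 ℕ.+ i ℕ.* 3 ℕ.+ (6 ℕ.* i ℕ.+ 9 ℕ.* u)) ≡ 3 ℕ.* (1 ℕ.* suc i ℕ.+ 3 ℕ.* (i ℕ.+ u))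
    rearrange₂ = solve-∀

  -- The squares of positive integers prime to 3 are the (3j + 1)² over all integers j, and (3j +
  -- 1)² = 1 + 3(2j + 3j²); hence T = y f(y¹⁵, y³).
  T≈Θ : ∀ K y → T K y ≈ y * Θ K (y ^ 3) 5 1
  T≈Θ K y = trans (∑-cong K λ i → trans (+-cong
      (trans (^-≡ y (≡.trans (rearrange₁ i) (≡.trans (≡.cong (λ e → 1 ℕ.+ (i ℕ.* 6 ℕ.+ e ℕ.* 9)) (C₂-square i)) (rearrange₂ i (C₂ i))))) (*-congˡ (sym (^-assocʳ y 3 (5 ℕ.* i ℕ.+ 6 ℕ.* C₂ i)))))
      (trans (^-≡ y (≡.trans (rearrange₃ i) (≡.trans (≡.cong (λ e → 4 ℕ.+ (i ℕ.* 12 ℕ.+ e ℕ.* 9)) (C₂-square i)) (rearrange₄ i (C₂ i))))) (*-congˡ (sym (^-assocʳ y 3 (1 ℕ.* suc i ℕ.+ 6 ℕ.* C₂ (suc i)))))))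
      (sym (distribˡ y _ _)))
    (∑-*ˡ K y _)
    where
    rearrange₁ : ∀ i → (1 ℕ.+ i ℕ.* 3) ℕ.* (1 ℕ.+ i ℕ.* 3) ≡ 1 ℕ.+ (i ℕ.* 6 ℕ.+ i ℕ.* i ℕ.* 9)
    rearrange₁ = solve-∀
    rearrange₂ : ∀ i u → 1 ℕ.+ (i ℕ.* 6 ℕ.+ (1 ℕ.* i ℕ.+ 2 ℕ.* u) ℕ.* 9) ≡ suc (3 ℕ.* (5 ℕ.* i ℕ.+ 6 ℕ.* u))
    rearrange₂ = solve-∀
    rearrange₃ : ∀ i → (2 ℕ.+ i ℕ.* 3) ℕ.* (2 ℕ.+ i ℕ.* 3) ≡ 4 ℕ.+ (i ℕ.* 12 ℕ.+ i ℕ.* i ℕ.* 9)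
    rearrange₃ = solve-∀
    rearrange₄ : ∀ i u → 4 ℕ.+ (i ℕ.* 12 ℕ.+ (1 ℕ.* i ℕ.+ 2 ℕ.* u) ℕ.* 9) ≡ suc (3 ℕ.* (1 ℕ.* suc i ℕ.+ 6 ℕ.* (i ℕ.+ u)))
    rearrange₄ = solve-∀

  -- The triangular numbers of index 3i + 1 are 1 plus nine times a triangular number; those of the
  -- other indices are divisible by 3.
  ψ-dissection : ∀ {K y} → K Kills y → ψ K y ≈ A K y + y * ψ K (y ^ 9)
  ψ-dissection {K} {y} yᴷ≈0 = begin
    ψ K y                                                              ≈⟨ ψ-stable yᴷ≈0 (ℕ.m≤m*n K 3) ⟨
    ψ (K ℕ.* 3) y                                                      ≈⟨ ∑-blocks K 3 _ ⟩
    ∑ K (λ i → y ^ C₂ (1 ℕ.+ i ℕ.* 3) + (y ^ C₂ (2 ℕ.+ i ℕ.* 3) + (y ^ C₂ (3 ℕ.+ i ℕ.* 3) + 0#))) ≈⟨ ∑-cong K (λ i →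
      solve 3 (λ u v w → u :+ (v :+ (w :+ con 0)) := (u :+ w) :+ v) refl _ _ _) ⟩
    ∑ K (λ i → y ^ C₂ (1 ℕ.+ i ℕ.* 3) + y ^ C₂ (3 ℕ.+ i ℕ.* 3) + y ^ C₂ (2 ℕ.+ i ℕ.* 3)) ≈⟨ ∑-zip K _ _ ⟩
    A K y + ∑ K (λ i → y ^ C₂ (2 ℕ.+ i ℕ.* 3))                         ≈⟨ +-congˡ (∑-cong K λ i → trans
      (^-≡ y (≡.trans (≡.cong (1 ℕ.+ i ℕ.* 3 ℕ.+_) (C₂-progression 3 i)) (rearrange i (C₂ i))))
      (*-congˡ (sym (^-assocʳ y 9 (C₂ (suc i)))))) ⟩
    A K y + ∑ K (λ i → y * (y ^ 9) ^ C₂ (suc i))                       ≈⟨ +-congˡ (∑-*ˡ K y _) ⟩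
    A K y + y * ψ K (y ^ 9)                                            ∎
    where
    rearrange : ∀ i u → 1 ℕ.+ i ℕ.* 3 ℕ.+ (6 ℕ.* i ℕ.+ 9 ℕ.* u) ≡ suc (9 ℕ.* (i ℕ.+ u))
    rearrange = solve-∀

  S-dissection : ∀ {K y} → K Kills y → S K y ≈ T K y + S K (y ^ 9)
  S-dissection {K} {y} yᴷ≈0 = begin
    S K y                                                              ≈⟨ S-stable yᴷ≈0 (ℕ.m≤m*n K 3) ⟨
    S (K ℕ.* 3) y                                                      ≈⟨ ∑-blocks K 3 _ ⟩
    ∑ K (λ i → q (1 ℕ.+ i ℕ.* 3) + (q (2 ℕ.+ i ℕ.* 3) + (q (3 ℕ.+ i ℕ.* 3) + 0#)))  ≈⟨ ∑-cong K (λ i →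
      solve 3 (λ u v w → u :+ (v :+ (w :+ con 0)) := (u :+ v) :+ w) refl _ _ _) ⟩
    ∑ K (λ i → q (1 ℕ.+ i ℕ.* 3) + q (2 ℕ.+ i ℕ.* 3) + q (3 ℕ.+ i ℕ.* 3))           ≈⟨ ∑-zip K _ _ ⟩
    T K y + ∑ K (λ i → q (3 ℕ.+ i ℕ.* 3))                              ≈⟨ +-congˡ (∑-cong K λ i →
      trans (^-≡ y (rearrange i)) (sym (^-assocʳ y 9 (suc i ℕ.* suc i)))) ⟩
    T K y + S K (y ^ 9)                                                ∎
    where
    q : ℕ → Carrier
    q n = y ^ (n ℕ.* n)
    rearrange : ∀ i → (3 ℕ.+ i ℕ.* 3) ℕ.* (3 ℕ.+ i ℕ.* 3) ≡ 9 ℕ.* (suc i ℕ.* suc i)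
    rearrange = solve-∀

  φ≈1+2S : ∀ {K y} → K Kills y → φ K y ≈ 1# + (S K y + S K y)
  φ≈1+2S {K} {y} yᴷ≈0 = begin
    -- One more summand is taken so that the sum of the y^(i²) can give up its entry at 0 and still
    -- leave `S K y`.
    φ K y                                     ≈⟨ φ-stable yᴷ≈0 (ℕ.n≤1+n K) ⟨
    φ (suc K) y                               ≈⟨ ∑-zip (suc K) (λ i → y ^ (i ℕ.* i)) (λ i → y ^ (suc i ℕ.* suc i)) ⟩
    (1# + S K y) + S (suc K) y                ≈⟨ +-congˡ (S-stable yᴷ≈0 (ℕ.n≤1+n K)) ⟩
    (1# + S K y) + S K y                      ≈⟨ +-assoc _ _ _ ⟩
    1# + (S K y + S K y)                      ∎

  even-power : ∀ {x y} → y ≈ - x → ∀ n → y ^ (n ℕ.* 2) ≈ x ^ (n ℕ.* 2)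
  even-power y≈-x zero    = refl
  even-power {x} {y} y≈-x (suc n) = begin
    y * (y * y ^ (n ℕ.* 2))        ≈⟨ *-assoc _ _ _ ⟨
    y * y * y ^ (n ℕ.* 2)          ≈⟨ *-cong square (even-power y≈-x n) ⟩
    x * x * x ^ (n ℕ.* 2)          ≈⟨ *-assoc _ _ _ ⟩
    x * (x * x ^ (n ℕ.* 2))        ∎
    where
    square : y * y ≈ x * x
    square = begin
      y * y         ≈⟨ *-cong y≈-x y≈-x ⟩
      - x * - x     ≈⟨ -‿distribˡ-* x (- x) ⟨
      - (x * - x)   ≈⟨ -‿cong (-‿distribʳ-* x x) ⟨
      - (- (x * x)) ≈⟨ -‿involutive _ ⟩
      x * x         ∎

  odd-power : ∀ {x y} → y ≈ - x → ∀ n → y ^ suc (n ℕ.* 2) ≈ - x ^ suc (n ℕ.* 2)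
  odd-power {x} {y} y≈-x n = trans (*-cong y≈-x (even-power y≈-x n)) (sym (-‿distribˡ-* x _))

  -- By the triple product ψ(y) contributes each 1 + y^j with j odd once and 1 - y^j for 4 | j.
  -- Multiplying by D doubles the odd factors and adds the even j not divisible by 4, which gives
  -- the product for f(y, y).
  ψD≈φ : ∀ {K x y} → y ≈ - x → K Kills y → ψ K y * D K x ≈ φ K y
  ψD≈φ {K} {x} {y} y≈-x yᴷ≈0 = begin
    ψ K y * D K x
      ≈⟨ *-congʳ (trans (ψ≈Θ yᴷ≈0) (Θ-product 2 0 yᴷ≈0)) ⟩
    ∏ K (λ k → (1# + y ^ (3 ℕ.+ k ℕ.* 4)) * ((1# + y ^ (1 ℕ.+ k ℕ.* 4)) * (1# - y ^ (4 ℕ.+ k ℕ.* 4)))) * D K x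
      ≈⟨ ∏-zip K _ _ ⟨
    ∏ K (λ k → (1# + y ^ (3 ℕ.+ k ℕ.* 4)) * ((1# + y ^ (1 ℕ.+ k ℕ.* 4)) * (1# - y ^ (4 ℕ.+ k ℕ.* 4)))
      * ((1# - x ^ (1 ℕ.+ k ℕ.* 4)) * ((1# - x ^ (2 ℕ.+ k ℕ.* 4)) * ((1# - x ^ (3 ℕ.+ k ℕ.* 4)) * 1#))))
      ≈⟨ ∏-cong K block ⟩
    ∏ K (λ k → g (0 ℕ.+ k ℕ.* 2) * (g (1 ℕ.+ k ℕ.* 2) * 1#))
      ≈⟨ ∏-blocks K 2 g ⟨
    ∏ (K ℕ.* 2) g
      ≈⟨ Θ-product 0 0 (kills-mono (ℕ.m≤m*n K 2) yᴷ≈0) ⟨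
    Θ (K ℕ.* 2) y 1 1
      ≈⟨ φ≈Θ (K ℕ.* 2) y ⟨
    φ (K ℕ.* 2) y
      ≈⟨ φ-stable yᴷ≈0 (ℕ.m≤m*n K 2) ⟩
    φ K y ∎
    where
    g : ℕ → Carrier
    g n = (1# + y ^ (1 ℕ.+ n ℕ.* 2)) * ((1# + y ^ (1 ℕ.+ n ℕ.* 2)) * (1# - y ^ (2 ℕ.+ n ℕ.* 2)))
    twice : ∀ k → k ℕ.* 4 ≡ k ℕ.* 2 ℕ.* 2
    twice k = ≡.sym (ℕ.*-assoc k 2 2)
    odd : ∀ n → 1# - x ^ suc (n ℕ.* 2) ≈ 1# + y ^ suc (n ℕ.* 2)
    odd n = +-congˡ (sym (odd-power y≈-x n))
    block : ∀ k → (1# + y ^ (3 ℕ.+ k ℕ.* 4)) * ((1# + y ^ (1 ℕ.+ k ℕ.* 4)) * (1# - y ^ (4 ℕ.+ k ℕ.* 4)))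
      * ((1# - x ^ (1 ℕ.+ k ℕ.* 4)) * ((1# - x ^ (2 ℕ.+ k ℕ.* 4)) * ((1# - x ^ (3 ℕ.+ k ℕ.* 4)) * 1#)))
      ≈ g (0 ℕ.+ k ℕ.* 2) * (g (1 ℕ.+ k ℕ.* 2) * 1#)
    block k rewrite twice k = trans
      (*-congˡ (*-cong (odd (k ℕ.* 2)) (*-cong (+-congˡ (-‿cong (sym (even-power y≈-x (suc (k ℕ.* 2)))))) (*-congʳ (odd (suc (k ℕ.* 2)))))))
      (solve 4 (λ u v w t → v :* (u :* t) :* (u :* (w :* (v :* con 1))) := (u :* (u :* w)) :* ((v :* (v :* t)) :* con 1)) refl _ _ _ _)

  mod4-identity : ∀ {K x y G} → 1# + 1# + (1# + 1#) ≈ 0# → y ≈ - x → K Kills y →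
    let ψ₉ = ψ K (y ^ 9) in
    G * D K x ≈ D K (x ^ 9) →
    A K y * T K y + A K y * T K y ≈ y * ψ₉ + y * ψ₉ →
    ψ₉ * (G + (y + (y * T K y + y * T K y))) ≈ A K y
  mod4-identity {K} {x} {y} {G} 4≈0 y≈-x yᴷ≈0 GD≈D₉ 2AT≈2yψ₉ = begin
    ψ₉ * (G + (y + (y * t + y * t)))
      ≈⟨ solve 4 (λ p g y t → p :* (g :+ (y :+ (y :* t :+ y :* t))) := g :* p :+ (y :* p :+ (y :* p :* t :+ y :* p :* t))) refl _ _ _ _ ⟩
    G * ψ₉ + (y * ψ₉ + (y * ψ₉ * t + y * ψ₉ * t))
      ≈⟨ +-congʳ Gψ₉ ⟩
    (A K y + y * ψ₉) * (1# + (t + t)) + (y * ψ₉ + (y * ψ₉ * t + y * ψ₉ * t))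
      ≈⟨ solve 3 (λ a p t → (a :+ p) :* (con 1 :+ (t :+ t)) :+ (p :+ (p :* t :+ p :* t))
                        := a :+ ((a :* t :+ a :* t) :+ (p :+ p)) :+ (con 1 :+ con 1 :+ (con 1 :+ con 1)) :* (p :* t)) refl _ _ _ ⟩
    A K y + ((A K y * t + A K y * t) + (y * ψ₉ + y * ψ₉)) + (1# + 1# + (1# + 1#)) * (y * ψ₉ * t)
      ≈⟨ +-cong (+-congˡ (+-congʳ 2AT≈2yψ₉)) (zero-*ˡ 4≈0) ⟩
    A K y + ((y * ψ₉ + y * ψ₉) + (y * ψ₉ + y * ψ₉)) + 0#
      ≈⟨ solve 2 (λ a p → a :+ ((p :+ p) :+ (p :+ p)) :+ con 0 := a :+ (con 1 :+ con 1 :+ (con 1 :+ con 1)) :* p) refl _ _ ⟩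
    A K y + (1# + 1# + (1# + 1#)) * (y * ψ₉)
      ≈⟨ +-congˡ (zero-*ˡ 4≈0) ⟩
    A K y + 0#
      ≈⟨ +-identityʳ _ ⟩
    A K y ∎
    where
    ψ₉ = ψ K (y ^ 9)
    φ₁ = φ K y
    t  = T K y
    y⁹ᴷ≈0 : K Kills (y ^ 9)
    y⁹ᴷ≈0 = ^-kills 8 yᴷ≈0
    s₉ = S K (y ^ 9)
    φ²≈1 : φ₁ * φ₁ ≈ 1#
    φ²≈1 = begin
      φ₁ * φ₁                                     ≈⟨ *-cong (φ≈1+2S yᴷ≈0) (φ≈1+2S yᴷ≈0) ⟩
      (1# + (S K y + S K y)) * (1# + (S K y + S K y)) ≈⟨ solve 1 (λ s → (con 1 :+ (s :+ s)) :* (con 1 :+ (s :+ s))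
        := con 1 :+ (con 1 :+ con 1 :+ (con 1 :+ con 1)) :* (s :+ s :* s)) refl (S K y) ⟩
      1# + (1# + 1# + (1# + 1#)) * (S K y + S K y * S K y) ≈⟨ 1+≈1 (zero-*ˡ 4≈0) ⟩
      1#                                          ∎
    φφ₉ : φ₁ * φ K (y ^ 9) ≈ 1# + (t + t)
    φφ₉ = begin
      φ₁ * φ K (y ^ 9)                                       ≈⟨ *-cong
        (trans (φ≈1+2S yᴷ≈0) (+-congˡ (+-cong (S-dissection yᴷ≈0) (S-dissection yᴷ≈0)))) (φ≈1+2S y⁹ᴷ≈0) ⟩
      (1# + (t + s₉ + (t + s₉))) * (1# + (s₉ + s₉))          ≈⟨ solve 2 (λ t s → (con 1 :+ (t :+ s :+ (t :+ s))) :* (con 1 :+ (s :+ s))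
        := con 1 :+ (t :+ t) :+ (con 1 :+ con 1 :+ (con 1 :+ con 1)) :* (s :+ (s :* t :+ s :* s))) refl t s₉ ⟩
      1# + (t + t) + (1# + 1# + (1# + 1#)) * (s₉ + (s₉ * t + s₉ * s₉)) ≈⟨ trans (+-congˡ (zero-*ˡ 4≈0)) (+-identityʳ _) ⟩
      1# + (t + t)                                           ∎
    Gψ₉ : G * ψ₉ ≈ (A K y + y * ψ₉) * (1# + (t + t))
    Gψ₉ = begin
      -- Inserting φ² = 1 makes room for one factor φ = ψD, whose D is what G can absorb.
      G * ψ₉                                ≈⟨ trans (*-congˡ φ²≈1) (*-identityʳ _) ⟨
      G * ψ₉ * (φ₁ * φ₁)                    ≈⟨ *-congˡ (*-congʳ (ψD≈φ y≈-x yᴷ≈0)) ⟨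
      G * ψ₉ * (ψ K y * D K x * φ₁)         ≈⟨ solve 5 (λ g p q d f → g :* p :* (q :* d :* f) := q :* (f :* (p :* (g :* d)))) refl _ _ _ _ _ ⟩
      ψ K y * (φ₁ * (ψ₉ * (G * D K x)))     ≈⟨ *-congˡ (*-congˡ (*-congˡ GD≈D₉)) ⟩
      ψ K y * (φ₁ * (ψ₉ * D K (x ^ 9)))     ≈⟨ *-congˡ (*-congˡ (ψD≈φ (odd-power y≈-x 4) y⁹ᴷ≈0)) ⟩
      ψ K y * (φ₁ * φ K (y ^ 9))            ≈⟨ *-cong (ψ-dissection yᴷ≈0) φφ₉ ⟩
      (A K y + y * ψ₉) * (1# + (t + t))     ∎

  -- Product identities in characteristic 2

  module Characteristic2 (2≈0 : 1# + 1# ≈ 0#) where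

    x+x≈0 : ∀ x → x + x ≈ 0#
    x+x≈0 x = trans (sym (trans (distribʳ x 1# 1#) (+-cong (*-identityˡ x) (*-identityˡ x)))) (zero-*ˡ 2≈0)

    -x≈x : ∀ x → - x ≈ x
    -x≈x x = begin
      - x            ≈⟨ +-identityʳ _ ⟨
      - x + 0#       ≈⟨ +-congˡ (x+x≈0 x) ⟨
      - x + (x + x)  ≈⟨ +-assoc _ _ _ ⟨
      - x + x + x    ≈⟨ +-congʳ (-‿inverseˡ x) ⟩
      0# + x         ≈⟨ +-identityˡ x ⟩
      x              ∎

    1-≈1+ : ∀ x → 1# - x ≈ 1# + x
    1-≈1+ x = +-congˡ (-x≈x x)

    frobenius : ∀ x → (1# + x) * (1# + x) ≈ 1# + x * x
    frobenius x = begin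
      (1# + x) * (1# + x)      ≈⟨ solve 1 (λ x → (con 1 :+ x) :* (con 1 :+ x) := con 1 :+ x :* x :+ (x :+ x)) refl x ⟩
      1# + x * x + (x + x)     ≈⟨ trans (+-congˡ (x+x≈0 x)) (+-identityʳ _) ⟩
      1# + x * x               ∎

    Unit : Carrier → Set _
    Unit x = ∃ λ u → u * x ≈ 1#

    1+nilpotent-unit : ∀ {n x} → n Kills x → Unit (1# + x)
    1+nilpotent-unit {n} {x} (kills xⁿ≈0) = ∑ n (x ^_) , (begin
      ∑ n (x ^_) * (1# + x)             ≈⟨ *-comm _ _ ⟩
      (1# + x) * ∑ n (x ^_)             ≈⟨ *-congʳ (1-≈1+ x) ⟨
      (1# - x) * ∑ n (x ^_)             ≈⟨ +-identityʳ _ ⟨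
      (1# - x) * ∑ n (x ^_) + 0#        ≈⟨ +-congˡ xⁿ≈0 ⟨
      (1# - x) * ∑ n (x ^_) + x ^ n     ≈⟨ geometric n x ⟩
      1#                                ∎)

    *-unit : ∀ {x y} → Unit x → Unit y → Unit (x * y)
    *-unit (u , ux≈1) (v , vy≈1) = u * v ,
      trans (solve 4 (λ u v x y → u :* v :* (x :* y) := (u :* x) :* (v :* y)) refl _ _ _ _) (trans (*-cong ux≈1 vy≈1) (*-identityˡ 1#))

    ∏-unit : ∀ n {f} → (∀ i → Unit (f i)) → Unit (∏ n f)
    ∏-unit zero    units = 1# , *-identityˡ 1#
    ∏-unit (suc n) units = *-unit (units 0) (∏-unit n (units ∘ suc))

    module _ {K : ℕ} {z : Carrier} (zᴷ≈0 : K Kills z) where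
      private
        z-vanish : ∀ {n} → K ≤ n → z ^ n ≈ 0#
        z-vanish = ^-vanish zᴷ≈0

        p : ℕ → ℕ → Carrier
        p j k = 1# + z ^ (j ℕ.+ k ℕ.* 6)

        -- Squaring the factors in characteristic 2 gives P 2j = (P j)² (P (j + 3))²; cancelling P 2 P 4 in
        -- the product of the cases j = 1, 2 leaves the one relation needed between the P j.
        P : ℕ → Carrier
        P j = ∏ K (p j)

        P-unit : ∀ j → Unit (P (suc j))
        P-unit j = ∏-unit K λ i → 1+nilpotent-unit (^-kills (j ℕ.+ i ℕ.* 6) zᴷ≈0)

        -- Separates even and odd k, that is, exponents modulo 12, the modulus that squares of the
        -- factors live on.
        P-halves : ∀ j → P j ≈ ∏ K (λ k → p j (k ℕ.* 2) * p j (1 ℕ.+ k ℕ.* 2))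
        P-halves j = begin
          P j                                                    ≈⟨ ∏-stable _ (ℕ.m≤m*n K 2) (λ i K≤i → 1+≈1
            (z-vanish (ℕ.≤-trans K≤i (ℕ.≤-trans (ℕ.m≤m*n i 6) (ℕ.m≤n+m _ j))))) ⟨
          ∏ (K ℕ.* 2) (p j)                                      ≈⟨ ∏-blocks K 2 (p j) ⟩
          ∏ K (λ k → p j (k ℕ.* 2) * (p j (1 ℕ.+ k ℕ.* 2) * 1#)) ≈⟨ ∏-cong K (λ k → *-congˡ (*-identityʳ _)) ⟩
          ∏ K (λ k → p j (k ℕ.* 2) * p j (1 ℕ.+ k ℕ.* 2))        ∎

        p-square : ∀ j k → p j k * p j k ≈ 1# + z ^ ((j ℕ.+ k ℕ.* 6) ℕ.+ (j ℕ.+ k ℕ.* 6))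
        p-square j k = trans (frobenius _) (+-congˡ (sym (^-homo-* z (j ℕ.+ k ℕ.* 6) (j ℕ.+ k ℕ.* 6))))

        P-double : ∀ j → P (j ℕ.+ j) ≈ (P j * P j) * (P (3 ℕ.+ j) * P (3 ℕ.+ j))
        P-double j = begin
          P (j ℕ.+ j)
            ≈⟨ P-halves (j ℕ.+ j) ⟩
          ∏ K (λ k → p (j ℕ.+ j) (k ℕ.* 2) * p (j ℕ.+ j) (1 ℕ.+ k ℕ.* 2))
            ≈⟨ ∏-cong K (λ k → *-cong
                 (trans (+-congˡ (^-≡ z (rearrange₁ j k))) (sym (p-square j k)))
                 (trans (+-congˡ (^-≡ z (rearrange₂ j k))) (sym (p-square (3 ℕ.+ j) k)))) ⟩
          ∏ K (λ k → (p j k * p j k) * (p (3 ℕ.+ j) k * p (3 ℕ.+ j) k))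
            ≈⟨ ∏-zip K _ _ ⟩
          ∏ K (λ k → p j k * p j k) * ∏ K (λ k → p (3 ℕ.+ j) k * p (3 ℕ.+ j) k)
            ≈⟨ *-cong (∏-zip K _ _) (∏-zip K _ _) ⟩
          (P j * P j) * (P (3 ℕ.+ j) * P (3 ℕ.+ j)) ∎
          where
          rearrange₁ : ∀ j k → j ℕ.+ j ℕ.+ k ℕ.* 2 ℕ.* 6 ≡ (j ℕ.+ k ℕ.* 6) ℕ.+ (j ℕ.+ k ℕ.* 6)
          rearrange₁ = solve-∀
          rearrange₂ : ∀ j k → j ℕ.+ j ℕ.+ (1 ℕ.+ k ℕ.* 2) ℕ.* 6 ≡ (3 ℕ.+ j ℕ.+ k ℕ.* 6) ℕ.+ (3 ℕ.+ j ℕ.+ k ℕ.* 6)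
          rearrange₂ = solve-∀

        P-relation : (P 1 * P 1) * (P 5 * P 5) * (P 2 * P 4) ≈ 1#
        P-relation = begin
          w                      ≈⟨ *-identityˡ w ⟨
          1# * w                 ≈⟨ *-congʳ (proj₂ unit) ⟨
          u * (P 2 * P 4) * w    ≈⟨ *-assoc _ _ _ ⟩
          u * (P 2 * P 4 * w)    ≈⟨ *-congˡ (begin
            P 2 * P 4 * w        ≈⟨ solve 4 (λ a b c d → b :* c :* ((a :* a) :* (d :* d) :* (b :* c))
                                      := ((a :* a) :* (c :* c)) :* ((b :* b) :* (d :* d))) refl (P 1) (P 2) (P 4) (P 5) ⟩
            ((P 1 * P 1) * (P 4 * P 4)) * ((P 2 * P 2) * (P 5 * P 5)) ≈⟨ *-cong (P-double 1) (P-double 2) ⟨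
            P 2 * P 4            ∎) ⟩
          u * (P 2 * P 4)        ≈⟨ proj₂ unit ⟩
          1#                     ∎
          where
          w = (P 1 * P 1) * (P 5 * P 5) * (P 2 * P 4)
          unit = *-unit (P-unit 1) (P-unit 3)
          u = proj₁ unit

        -- The product for f(z², z) runs over exponents modulo 3; twice the length allows regrouping
        -- modulo 6, and signs do not matter in characteristic 2.
        Θ₂₁ : Θ K z 2 1 ≈ (P 2 * (P 1 * P 3)) * (P 5 * (P 4 * P 6))
        Θ₂₁ = begin
          Θ K z 2 1
            ≈⟨ Θ-stable 1 0 zᴷ≈0 (ℕ.m≤m*n K 2) ⟨
          Θ (K ℕ.* 2) z 2 1
            ≈⟨ Θ-product 1 0 (kills-mono (ℕ.m≤m*n K 2) zᴷ≈0) ⟩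
          ∏ (K ℕ.* 2) g
            ≈⟨ ∏-blocks K 2 g ⟩
          ∏ K (λ k → g (k ℕ.* 2) * (g (1 ℕ.+ k ℕ.* 2) * 1#))
            ≈⟨ ∏-cong K block ⟩
          ∏ K (λ k → (p 2 k * (p 1 k * p 3 k)) * (p 5 k * (p 4 k * p 6 k)))
            ≈⟨ ∏-zip K _ _ ⟩
          ∏ K (λ k → p 2 k * (p 1 k * p 3 k)) * ∏ K (λ k → p 5 k * (p 4 k * p 6 k))
            ≈⟨ *-cong (trans (∏-zip K _ _) (*-congˡ (∏-zip K _ _))) (trans (∏-zip K _ _) (*-congˡ (∏-zip K _ _))) ⟩
          (P 2 * (P 1 * P 3)) * (P 5 * (P 4 * P 6)) ∎
          where
          g : ℕ → Carrier
          g n = (1# + z ^ (2 ℕ.+ n ℕ.* 3)) * ((1# + z ^ (1 ℕ.+ n ℕ.* 3)) * (1# - z ^ (3 ℕ.+ n ℕ.* 3)))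
          block : ∀ k → g (k ℕ.* 2) * (g (1 ℕ.+ k ℕ.* 2) * 1#) ≈ (p 2 k * (p 1 k * p 3 k)) * (p 5 k * (p 4 k * p 6 k))
          block k rewrite ℕ.*-assoc k 2 3 =
            *-cong (*-congˡ (*-congˡ (1-≈1+ _))) (trans (*-identityʳ _) (*-congˡ (*-congˡ (1-≈1+ _))))

        Θ₅₁ : Θ K z 5 1 ≈ P 5 * (P 1 * P 6)
        Θ₅₁ = begin
          Θ K z 5 1                                    ≈⟨ Θ-product 4 0 zᴷ≈0 ⟩
          ∏ K (λ k → p 5 k * (p 1 k * (1# - z ^ (6 ℕ.+ k ℕ.* 6)))) ≈⟨ ∏-cong K (λ k → *-congˡ (*-congˡ (1-≈1+ _))) ⟩
          ∏ K (λ k → p 5 k * (p 1 k * p 6 k))          ≈⟨ trans (∏-zip K _ _) (*-congˡ (∏-zip K _ _)) ⟩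
          P 5 * (P 1 * P 6)                            ∎

        -- In f(z⁹, z³) the exponents 12k + 3 and 12k + 9 together make up 6k + 3, while 12k + 12 is
        -- twice 6k + 6 and gives a square.
        ψ₃ : ψ K (z ^ 3) ≈ P 3 * (P 6 * P 6)
        ψ₃ = begin
          ψ K (z ^ 3)
            ≈⟨ ψ≈Θ z³ᴷ≈0 ⟩
          Θ K (z ^ 3) 3 1
            ≈⟨ Θ-product 2 0 z³ᴷ≈0 ⟩
          ∏ K (λ k → (1# + (z ^ 3) ^ (3 ℕ.+ k ℕ.* 4)) * ((1# + (z ^ 3) ^ (1 ℕ.+ k ℕ.* 4)) * (1# - (z ^ 3) ^ (4 ℕ.+ k ℕ.* 4))))
            ≈⟨ ∏-cong K block ⟩
          ∏ K (λ k → (p 3 (k ℕ.* 2) * p 3 (1 ℕ.+ k ℕ.* 2)) * (p 6 k * p 6 k))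
            ≈⟨ ∏-zip K _ _ ⟩
          ∏ K (λ k → p 3 (k ℕ.* 2) * p 3 (1 ℕ.+ k ℕ.* 2)) * ∏ K (λ k → p 6 k * p 6 k)
            ≈⟨ *-cong (P-halves 3) (sym (∏-zip K _ _)) ⟨
          P 3 * (P 6 * P 6) ∎
          where
          z³ᴷ≈0 : K Kills (z ^ 3)
          z³ᴷ≈0 = ^-kills 2 zᴷ≈0
          rearrange₁ : ∀ k → 3 ℕ.* (3 ℕ.+ k ℕ.* 4) ≡ 3 ℕ.+ (1 ℕ.+ k ℕ.* 2) ℕ.* 6
          rearrange₁ = solve-∀
          rearrange₂ : ∀ k → 3 ℕ.* (1 ℕ.+ k ℕ.* 4) ≡ 3 ℕ.+ k ℕ.* 2 ℕ.* 6
          rearrange₂ = solve-∀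
          rearrange₃ : ∀ k → 3 ℕ.* (4 ℕ.+ k ℕ.* 4) ≡ (6 ℕ.+ k ℕ.* 6) ℕ.+ (6 ℕ.+ k ℕ.* 6)
          rearrange₃ = solve-∀
          cube : ∀ m {n} → 3 ℕ.* m ≡ n → 1# + (z ^ 3) ^ m ≈ 1# + z ^ n
          cube m e = +-congˡ (trans (^-assocʳ z 3 m) (^-≡ z e))
          block : ∀ k → (1# + (z ^ 3) ^ (3 ℕ.+ k ℕ.* 4)) * ((1# + (z ^ 3) ^ (1 ℕ.+ k ℕ.* 4)) * (1# - (z ^ 3) ^ (4 ℕ.+ k ℕ.* 4)))
            ≈ (p 3 (k ℕ.* 2) * p 3 (1 ℕ.+ k ℕ.* 2)) * (p 6 k * p 6 k)
          block k = trans
            (*-cong (cube (3 ℕ.+ k ℕ.* 4) (rearrange₁ k)) (*-cong (cube (1 ℕ.+ k ℕ.* 4) (rearrange₂ k))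
              (trans (1-≈1+ _) (trans (cube (4 ℕ.+ k ℕ.* 4) (rearrange₃ k)) (sym (p-square 6 k))))))
            (solve 3 (λ u v w → u :* (v :* w) := (v :* u) :* w) refl _ _ _)

      Θ₂₁Θ₅₁≈ψ₃ : Θ K z 2 1 * Θ K z 5 1 ≈ ψ K (z ^ 3)
      Θ₂₁Θ₅₁≈ψ₃ = begin
        Θ K z 2 1 * Θ K z 5 1
          ≈⟨ *-cong Θ₂₁ Θ₅₁ ⟩
        (P 2 * (P 1 * P 3)) * (P 5 * (P 4 * P 6)) * (P 5 * (P 1 * P 6))
          ≈⟨ solve 6 (λ a b c d e f → (b :* (a :* c)) :* (e :* (d :* f)) :* (e :* (a :* f))
                := (a :* a) :* (e :* e) :* (b :* d) :* (c :* (f :* f))) refl (P 1) (P 2) (P 3) (P 4) (P 5) (P 6) ⟩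
        (P 1 * P 1) * (P 5 * P 5) * (P 2 * P 4) * (P 3 * (P 6 * P 6))
          ≈⟨ trans (*-congʳ P-relation) (*-identityˡ _) ⟩
        P 3 * (P 6 * P 6)
          ≈⟨ ψ₃ ⟨
        ψ K (z ^ 3) ∎

    AT≈yψ₉ : ∀ {K y} → K Kills y → A K y * T K y ≈ y * ψ K (y ^ 9)
    AT≈yψ₉ {K} {y} yᴷ≈0 = begin
      A K y * T K y                                ≈⟨ *-cong (A≈Θ K y) (T≈Θ K y) ⟩
      Θ K (y ^ 3) 2 1 * (y * Θ K (y ^ 3) 5 1)      ≈⟨ solve 3 (λ u y v → u :* (y :* v) := y :* (u :* v)) refl _ _ _ ⟩
      y * (Θ K (y ^ 3) 2 1 * Θ K (y ^ 3) 5 1)      ≈⟨ *-congˡ (Θ₂₁Θ₅₁≈ψ₃ (^-kills 2 yᴷ≈0)) ⟩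
      y * ψ K ((y ^ 3) ^ 3)                        ≈⟨ *-congˡ (∑-cong K λ n → ^-congˡ (C₂ (suc n)) (^-assocʳ y 3 3)) ⟩
      y * ψ K (y ^ 9)                              ∎

-- From characteristic 2 to doubled identities in a ring with 4 = 0

module Doubled {c ℓ : Level} (R : CommutativeRing c ℓ) where
  open RingBase R
  private
    module θ = ThetaSeries R

  -- R modulo the annihilator of 2; it has characteristic 2 as soon as 4 = 0 in R.
  R/2 : CommutativeRing c ℓ
  R/2 = record
    { Carrier = Carrier
    ; _≈_     = λ x y → x + x ≈ y + y
    ; _+_     = _+_
    ; _*_     = _*_
    ; -_      = -_
    ; 0#      = 0#
    ; 1#      = 1#
    ; isCommutativeRing = record
      { isRing = record
        { +-isAbelianGroup = record
          { isGroup = record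
            { isMonoid = record
              { isSemigroup = record
                { isMagma = record
                  { isEquivalence = record { refl = refl ; sym = sym ; trans = trans }
                  ; ∙-cong        = λ p q → trans (swap _ _) (trans (+-cong p q) (sym (swap _ _)))
                  }
                ; assoc = λ x y z → double (+-assoc x y z)
                }
              ; identity = (λ x → double (+-identityˡ x)) , λ x → double (+-identityʳ x)
              }
            ; inverse = (λ x → double (-‿inverseˡ x)) , λ x → double (-‿inverseʳ x)
            ; ⁻¹-cong = λ {x} {y} p → begin
                - x + - x    ≈⟨ -‿+-comm x x ⟩
                - (x + x)    ≈⟨ -‿cong p ⟩
                - (y + y)    ≈⟨ -‿+-comm y y ⟨
                - y + - y    ∎
            }
          ; comm = λ x y → double (+-comm x y)
          }
        ; *-cong = λ {x} {y} {u} {v} p q → begin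
            x * u + x * u  ≈⟨ distribʳ u x x ⟨
            (x + x) * u    ≈⟨ *-congʳ p ⟩
            (y + y) * u    ≈⟨ solve 2 (λ y u → (y :+ y) :* u := y :* (u :+ u)) refl y u ⟩
            y * (u + u)    ≈⟨ *-congˡ q ⟩
            y * (v + v)    ≈⟨ distribˡ y v v ⟩
            y * v + y * v  ∎
        ; *-assoc    = λ x y z → double (*-assoc x y z)
        ; *-identity = (λ x → double (*-identityˡ x)) , λ x → double (*-identityʳ x)
        ; distrib    = (λ x y z → double (distribˡ x y z)) , λ x y z → double (distribʳ x y z)
        }
      ; *-comm = λ x y → double (*-comm x y)
      }
    }
    where
    open import Algebra.Properties.Ring ring using (-‿+-comm)
    double : ∀ {x y} → x ≈ y → x + x ≈ y + y
    double p = +-cong p p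
    swap : ∀ x y → (x + y) + (x + y) ≈ (x + x) + (y + y)
    swap = solve 2 (λ x y → (x :+ y) :+ (x :+ y) := (x :+ x) :+ (y :+ y)) refl

  private
    module R/2 = RingBase R/2
    module θ/2 = ThetaSeries R/2

    -- Both rings share their operations, but powers with a variable exponent are stuck on different
    -- bundles, so induction is required.
    ^-agree : ∀ x n → x R/2.^ n ≈ x ^ n
    ^-agree x zero    = refl
    ^-agree x (suc n) = *-congˡ (^-agree x n)

    ∑-agree : ∀ n {f g} → (∀ i → f i ≈ g i) → R/2.∑ n f ≈ ∑ n g
    ∑-agree zero    f≈g = refl
    ∑-agree (suc n) f≈g = +-cong (f≈g 0) (∑-agree n (f≈g ∘ suc))

  -- Equality in `R/2` is by definition equality of doubles in R, so the characteristic 2 identity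
  -- already is the claim once powers and sums are identified.
  2AT≈2yψ₉ : ∀ {K y} → 1# + 1# + (1# + 1#) ≈ 0# → K Kills y →
    θ.A K y * θ.T K y + θ.A K y * θ.T K y ≈ y * θ.ψ K (y ^ 9) + y * θ.ψ K (y ^ 9)
  2AT≈2yψ₉ {K} {y} 4≈0 (kills yᴷ≈0) = begin
    θ.A K y * θ.T K y + θ.A K y * θ.T K y                    ≈⟨ +-cong AT AT ⟨
    θ/2.A K y * θ/2.T K y + θ/2.A K y * θ/2.T K y            ≈⟨ θ/2.Characteristic2.AT≈yψ₉
      (trans 4≈0 (sym (+-identityʳ 0#))) {K} {y}
      (R/2.kills (let e = trans (^-agree y K) yᴷ≈0 in +-cong e e)) ⟩
    y * θ/2.ψ K (y R/2.^ 9) + y * θ/2.ψ K (y R/2.^ 9)        ≈⟨ +-cong yψ yψ ⟩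
    y * θ.ψ K (y ^ 9) + y * θ.ψ K (y ^ 9)                    ∎
    where
    AT : θ/2.A K y * θ/2.T K y ≈ θ.A K y * θ.T K y
    AT = *-cong
      (∑-agree K λ i → +-cong (^-agree y (C₂ (1 ℕ.+ i ℕ.* 3))) (^-agree y (C₂ (3 ℕ.+ i ℕ.* 3))))
      (∑-agree K λ i → +-cong (^-agree y ((1 ℕ.+ i ℕ.* 3) ℕ.* (1 ℕ.+ i ℕ.* 3))) (^-agree y ((2 ℕ.+ i ℕ.* 3) ℕ.* (2 ℕ.+ i ℕ.* 3))))
    yψ : y * θ/2.ψ K (y R/2.^ 9) ≈ y * θ.ψ K (y ^ 9)
    yψ = *-congˡ (∑-agree K λ n → trans (^-agree (y R/2.^ 9) (C₂ (suc n))) (^-congˡ (C₂ (suc n)) (^-agree y 9)))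

-- Truncated power series

Series : Set
Series = ℕ → ℤ.ℤ

module Convolution where
  open import Data.Integer using (0ℤ; 1ℤ; _+_; _*_)

  infixl 6 _⊕_
  infixl 7 _⊛_

  𝟘 𝟙 X : Series
  𝟘 _ = 0ℤ
  𝟙 zero    = 1ℤ
  𝟙 (suc _) = 0ℤ
  X zero    = 0ℤ
  X (suc n) = 𝟙 n

  _⊕_ _⊛_ : Series → Series → Series
  (f ⊕ g) n = f n + g n
  (f ⊛ g) zero    = f 0 * g 0
  (f ⊛ g) (suc n) = f 0 * g (suc n) + ((f ∘ suc) ⊛ g) n

  ⊛-sucʳ : ∀ f g n → (f ⊛ g) (suc n) ≡ f (suc n) * g 0 + (f ⊛ (g ∘ suc)) n
  ⊛-sucʳ f g zero    = ℤ.+-comm (f 0 * g 1) (f 1 * g 0)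
  ⊛-sucʳ f g (suc n) = ≡.trans (≡.cong (λ e → f 0 * g (suc (suc n)) + e) (⊛-sucʳ (f ∘ suc) g n))
    (rearrange (f 0 * g (suc (suc n))) (f (suc (suc n)) * g 0) (((f ∘ suc) ⊛ (g ∘ suc)) n))
    where
    rearrange : ∀ x y z → x + (y + z) ≡ y + (x + z)
    rearrange = ℤSolver.solve-∀

  ⊛-comm : ∀ f g n → (f ⊛ g) n ≡ (g ⊛ f) n
  ⊛-comm f g zero    = ℤ.*-comm (f 0) (g 0)
  ⊛-comm f g (suc n) = ≡.trans (≡.cong₂ _+_ (ℤ.*-comm (f 0) (g (suc n))) (⊛-comm (f ∘ suc) g n)) (≡.sym (⊛-sucʳ g f n))

  ⊛-distribʳ : ∀ h f g n → ((f ⊕ g) ⊛ h) n ≡ (f ⊛ h) n + (g ⊛ h) n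
  ⊛-distribʳ h f g zero    = ℤ.*-distribʳ-+ (h 0) (f 0) (g 0)
  ⊛-distribʳ h f g (suc n) = ≡.trans (≡.cong (λ e → (f 0 + g 0) * h (suc n) + e) (⊛-distribʳ h (f ∘ suc) (g ∘ suc) n))
    (rearrange (f 0) (g 0) (h (suc n)) (((f ∘ suc) ⊛ h) n) (((g ∘ suc) ⊛ h) n))
    where
    rearrange : ∀ a b x u v → (a + b) * x + (u + v) ≡ a * x + u + (b * x + v)
    rearrange = ℤSolver.solve-∀

  ⊛-distribˡ : ∀ h f g n → (h ⊛ (f ⊕ g)) n ≡ (h ⊛ f) n + (h ⊛ g) n
  ⊛-distribˡ h f g n = ≡.trans (⊛-comm h (f ⊕ g) n)
    (≡.trans (⊛-distribʳ h f g n) (≡.cong₂ _+_ (⊛-comm f h n) (⊛-comm g h n)))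

  ⊛-scaleˡ : ∀ a f g n → ((λ k → a * f k) ⊛ g) n ≡ a * (f ⊛ g) n
  ⊛-scaleˡ a f g zero    = ℤ.*-assoc a (f 0) (g 0)
  ⊛-scaleˡ a f g (suc n) = ≡.trans (≡.cong (λ e → a * f 0 * g (suc n) + e) (⊛-scaleˡ a (f ∘ suc) g n))
    (rearrange a (f 0) (g (suc n)) (((f ∘ suc) ⊛ g) n))
    where
    rearrange : ∀ a x y u → a * x * y + a * u ≡ a * (x * y + u)
    rearrange = ℤSolver.solve-∀

  ⊛-assoc : ∀ f g h n → ((f ⊛ g) ⊛ h) n ≡ (f ⊛ (g ⊛ h)) n
  ⊛-assoc f g h zero    = ℤ.*-assoc (f 0) (g 0) (h 0)
  ⊛-assoc f g h (suc n) = begin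
    f 0 * g 0 * h (suc n) + (((λ k → f 0 * g (suc k)) ⊕ ((f ∘ suc) ⊛ g)) ⊛ h) n
      ≡⟨ ≡.cong (λ e → f 0 * g 0 * h (suc n) + e) (⊛-distribʳ h (λ k → f 0 * g (suc k)) ((f ∘ suc) ⊛ g) n) ⟩
    f 0 * g 0 * h (suc n) + (((λ k → f 0 * g (suc k)) ⊛ h) n + (((f ∘ suc) ⊛ g) ⊛ h) n)
      ≡⟨ ≡.cong₂ (λ u v → f 0 * g 0 * h (suc n) + (u + v)) (⊛-scaleˡ (f 0) (g ∘ suc) h n) (⊛-assoc (f ∘ suc) g h n) ⟩
    f 0 * g 0 * h (suc n) + (f 0 * ((g ∘ suc) ⊛ h) n + ((f ∘ suc) ⊛ (g ⊛ h)) n)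
      ≡⟨ rearrange (f 0) (g 0) (h (suc n)) (((g ∘ suc) ⊛ h) n) (((f ∘ suc) ⊛ (g ⊛ h)) n) ⟩
    f 0 * (g 0 * h (suc n) + ((g ∘ suc) ⊛ h) n) + ((f ∘ suc) ⊛ (g ⊛ h)) n ∎
    where
    open ≡.≡-Reasoning
    rearrange : ∀ a b x u v → a * b * x + (a * u + v) ≡ a * (b * x + u) + v
    rearrange = ℤSolver.solve-∀

  ⊛-zeroˡ : ∀ f n → (𝟘 ⊛ f) n ≡ 0ℤ
  ⊛-zeroˡ f zero    = ≡.refl
  ⊛-zeroˡ f (suc n) = ≡.trans (ℤ.+-identityˡ _) (⊛-zeroˡ f n)

  ⊛-identityˡ : ∀ f n → (𝟙 ⊛ f) n ≡ f n
  ⊛-identityˡ f zero    = ℤ.*-identityˡ (f 0)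
  ⊛-identityˡ f (suc n) = ≡.trans (≡.cong₂ _+_ (ℤ.*-identityˡ (f (suc n))) (⊛-zeroˡ f n)) (ℤ.+-identityʳ (f (suc n)))

  X⊛-suc : ∀ f n → (X ⊛ f) (suc n) ≡ f n
  X⊛-suc f n = ≡.trans (ℤ.+-identityˡ _) (⊛-identityˡ f n)

module TruncatedSeries (m : ℤ.ℤ) (N : ℕ) where
  open Convolution
  open import Data.Integer using (ℤ; 0ℤ; _+_; _*_; _-_; -_)
  open import Data.Integer.Divisibility.Signed using (_∣_; divides; ∣m⇒∣-m; ∣m∣n⇒∣m+n; ∣m⇒∣m*n; ∣n⇒∣m*n)

  infix 4 _≡ₘ_ _≋_

  _≡ₘ_ : ℤ → ℤ → Set
  a ≡ₘ b = m ∣ a - b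

  ≡ₘ-reflexive : ∀ {a b} → a ≡ b → a ≡ₘ b
  ≡ₘ-reflexive {a} ≡.refl = divides 0ℤ (ℤ.+-inverseʳ a)

  ≡ₘ-sym : ∀ {a b} → a ≡ₘ b → b ≡ₘ a
  ≡ₘ-sym {a} {b} p = ≡.subst (m ∣_) (flip a b) (∣m⇒∣-m p)
    where
    flip : ∀ a b → - (a - b) ≡ b - a
    flip = ℤSolver.solve-∀

  ≡ₘ-trans : ∀ {a b c} → a ≡ₘ b → b ≡ₘ c → a ≡ₘ c
  ≡ₘ-trans {a} {b} {c} p q = ≡.subst (m ∣_) (telescope a b c) (∣m∣n⇒∣m+n p q)
    where
    telescope : ∀ a b c → (a - b) + (b - c) ≡ a - c
    telescope = ℤSolver.solve-∀

  ≡ₘ-+ : ∀ {a b c d} → a ≡ₘ b → c ≡ₘ d → a + c ≡ₘ b + d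
  ≡ₘ-+ {a} {b} {c} {d} p q = ≡.subst (m ∣_) (rearrange a b c d) (∣m∣n⇒∣m+n p q)
    where
    rearrange : ∀ a b c d → (a - b) + (c - d) ≡ (a + c) - (b + d)
    rearrange = ℤSolver.solve-∀

  ≡ₘ-neg : ∀ {a b} → a ≡ₘ b → - a ≡ₘ - b
  ≡ₘ-neg {a} {b} p = ≡.subst (m ∣_) (rearrange a b) (∣m⇒∣-m p)
    where
    rearrange : ∀ a b → - (a - b) ≡ - a - - b
    rearrange = ℤSolver.solve-∀

  ≡ₘ-* : ∀ {a b c d} → a ≡ₘ b → c ≡ₘ d → a * c ≡ₘ b * d
  ≡ₘ-* {a} {b} {c} {d} p q = ≡.subst (m ∣_) (rearrange a b c d) (∣m∣n⇒∣m+n (∣m⇒∣m*n c p) (∣n⇒∣m*n b q))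
    where
    rearrange : ∀ a b c d → (a - b) * c + b * (c - d) ≡ a * c - b * d
    rearrange = ℤSolver.solve-∀

  ⊛-cong : ∀ n {f f′ g g′} → (∀ i → i ≤ n → f i ≡ₘ f′ i) → (∀ i → i ≤ n → g i ≡ₘ g′ i) → (f ⊛ g) n ≡ₘ (f′ ⊛ g′) n
  ⊛-cong zero    {f} {f′} {g} {g′} p q = ≡ₘ-* {f 0} {f′ 0} {g 0} {g′ 0} (p 0 z≤n) (q 0 z≤n)
  ⊛-cong (suc n) {f} {f′} {g} {g′} p q =
    ≡ₘ-+ {f 0 * g (suc n)} {f′ 0 * g′ (suc n)} {((f ∘ suc) ⊛ g) n} {((f′ ∘ suc) ⊛ g′) n}
      (≡ₘ-* {f 0} {f′ 0} {g (suc n)} {g′ (suc n)} (p 0 z≤n) (q (suc n) ℕ.≤-refl))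
      (⊛-cong n (λ i i≤n → p (suc i) (s≤s i≤n)) (λ i i≤n → q i (ℕ.m≤n⇒m≤1+n i≤n)))

  -- Congruence modulo m in degrees at most N: the ring is (ℤ/m)[q]/(q^(N+1)), with honest integer
  -- sequences as representatives.
  record _≋_ (f g : Series) : Set where
    constructor coefficientwise
    field
      coefficient : ∀ n → n ≤ N → f n ≡ₘ g n

  open _≋_ public

  pointwise : ∀ {f g} → (∀ n → f n ≡ g n) → f ≋ g
  pointwise e = coefficientwise λ n _ → ≡ₘ-reflexive (e n)

  seriesRing : CommutativeRing 0ℓ 0ℓ
  seriesRing = record
    { Carrier = Series
    ; _≈_     = _≋_
    ; _+_     = _⊕_
    ; _*_     = _⊛_
    ; -_      = λ f n → - f n
    ; 0#      = 𝟘
    ; 1#      = 𝟙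
    ; isCommutativeRing = record
      { isRing = record
        { +-isAbelianGroup = record
          { isGroup = record
            { isMonoid = record
              { isSemigroup = record
                { isMagma = record
                  { isEquivalence = record
                    { refl  = pointwise λ _ → ≡.refl
                    ; sym   = λ {f} {g} p → coefficientwise λ n n≤N → ≡ₘ-sym {f n} {g n} (coefficient p n n≤N)
                    ; trans = λ {f} {g} {h} p q → coefficientwise λ n n≤N →
                        ≡ₘ-trans {f n} {g n} {h n} (coefficient p n n≤N) (coefficient q n n≤N)
                    }
                  ; ∙-cong = λ {f} {f′} {g} {g′} p q → coefficientwise λ n n≤N →
                      ≡ₘ-+ {f n} {f′ n} {g n} {g′ n} (coefficient p n n≤N) (coefficient q n n≤N)
                  }
                ; assoc = λ f g h → pointwise λ n → ℤ.+-assoc (f n) (g n) (h n)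
                }
              ; identity = (λ f → pointwise λ n → ℤ.+-identityˡ (f n)) , λ f → pointwise λ n → ℤ.+-identityʳ (f n)
              }
            ; inverse = (λ f → pointwise λ n → ℤ.+-inverseˡ (f n)) , λ f → pointwise λ n → ℤ.+-inverseʳ (f n)
            ; ⁻¹-cong = λ {f} {g} p → coefficientwise λ n n≤N → ≡ₘ-neg {f n} {g n} (coefficient p n n≤N)
            }
          ; comm = λ f g → pointwise λ n → ℤ.+-comm (f n) (g n)
          }
        ; *-cong = λ p q → coefficientwise λ n n≤N → ⊛-cong n
            (λ i i≤n → coefficient p i (ℕ.≤-trans i≤n n≤N)) (λ i i≤n → coefficient q i (ℕ.≤-trans i≤n n≤N))
        ; *-assoc    = λ f g h → pointwise (⊛-assoc f g h)
        ; *-identity = (λ f → pointwise (⊛-identityˡ f)) , λ f → pointwise λ n → ≡.trans (⊛-comm f 𝟙 n) (⊛-identityˡ f n)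
        ; distrib    = (λ h f g → pointwise (⊛-distribˡ h f g)) , λ h f g → pointwise (⊛-distribʳ h f g)
        }
      ; *-comm = λ f g → pointwise (⊛-comm f g)
      }
    }

-- Supports of truncated series

module Support (m : ℤ.ℤ) (N : ℕ) where
  open Convolution
  open TruncatedSeries m N
  open RingBase seriesRing using (_^_; ∑; _Kills_; kills; ^-assocʳ)
  open import Data.Integer using (0ℤ; _+_; _*_; _-_)
  open import Data.Integer.Divisibility.Signed using (_∣_; divides; ∣m∣n⇒∣m+n; ∣m⇒∣m*n; ∣n⇒∣m*n)

  SupportedOn : (ℕ → Set) → Series → Set
  SupportedOn P f = ∀ n → n ≤ N → ¬ P n → m ∣ f n

  m∣0 : m ∣ 0ℤ
  m∣0 = divides 0ℤ ≡.refl

  ≡ₘ-∣ : ∀ {a b} → a ≡ₘ b → m ∣ b → m ∣ a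
  ≡ₘ-∣ {a} {b} a≡b m∣b = ≡.subst (m ∣_) (restore a b) (∣m∣n⇒∣m+n a≡b m∣b)
    where
    restore : ∀ a b → (a - b) + b ≡ a
    restore = ℤSolver.solve-∀

  supported-≋ : ∀ {P f g} → f ≋ g → SupportedOn P g → SupportedOn P f
  supported-≋ {f = f} {g} f≋g supp n n≤N ¬Pn = ≡ₘ-∣ {f n} {g n} (coefficient f≋g n n≤N) (supp n n≤N ¬Pn)

  supported-mono : ∀ {P Q : ℕ → Set} {f} → (∀ n → P n → Q n) → SupportedOn P f → SupportedOn Q f
  supported-mono P⊆Q supp n n≤N ¬Qn = supp n n≤N (¬Qn ∘ P⊆Q n)

  supported-⊕ : ∀ {P f g} → SupportedOn P f → SupportedOn P g → SupportedOn P (f ⊕ g)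
  supported-⊕ p q n n≤N ¬Pn = ∣m∣n⇒∣m+n (p n n≤N ¬Pn) (q n n≤N ¬Pn)

  supported-∑ : ∀ {P} K {F} → (∀ i → SupportedOn P (F i)) → SupportedOn P (∑ K F)
  supported-∑ zero    supp n n≤N ¬Pn = m∣0
  supported-∑ (suc K) supp n n≤N ¬Pn = ∣m∣n⇒∣m+n (supp 0 n n≤N ¬Pn) (supported-∑ K (supp ∘ suc) n n≤N ¬Pn)

  ∣-⊛ : ∀ n {f g} → (∀ i j → i ℕ.+ j ≡ n → m ∣ f i * g j) → m ∣ (f ⊛ g) n
  ∣-⊛ zero    p = p 0 0 ≡.refl
  ∣-⊛ (suc n) p = ∣m∣n⇒∣m+n (p 0 (suc n) ≡.refl) (∣-⊛ n λ i j i+j≡n → p (suc i) j (≡.cong suc i+j≡n))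

  -- Assuming only support in degree 1 covers X and -X alike, so no signs of powers have to be
  -- tracked.
  supported-^ : ∀ {f} → SupportedOn (_≡ 1) f → ∀ e → SupportedOn (_≡ e) (f ^ e)
  supported-^ supp zero    zero    n≤N n≢e = contradiction ≡.refl n≢e
  supported-^ supp zero    (suc n) n≤N n≢e = m∣0
  supported-^ {f} supp (suc e) n n≤N n≢e = ∣-⊛ n summand
    where
    summand : ∀ i j → i ℕ.+ j ≡ n → m ∣ f i * (f ^ e) j
    summand i j ≡.refl with i ℕ.≟ 1
    ... | yes ≡.refl = ∣n⇒∣m*n (f 1) (supported-^ supp e j (ℕ.m+n≤o⇒n≤o 1 n≤N) (n≢e ∘ ≡.cong suc))
    ... | no  i≢1    = ∣m⇒∣m*n ((f ^ e) j) (supp i (ℕ.m+n≤o⇒m≤o i n≤N) i≢1)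

  supported-^^ : ∀ {f} → SupportedOn (_≡ 1) f → ∀ a b → SupportedOn (_≡ a ℕ.* b) ((f ^ a) ^ b)
  supported-^^ {f} supp a b = supported-≋ (^-assocʳ f a b) (supported-^ supp (a ℕ.* b))

  kills-supported : ∀ {f} → SupportedOn (_≡ 1) f → suc N Kills f
  kills-supported {f} supp = kills (coefficientwise λ n n≤N →
    ≡.subst (m ∣_) (≡.sym (ℤ.+-identityʳ _)) (supported-^ supp (suc N) n n≤N (ℕ.<⇒≢ (s≤s n≤N))))

  X-supported : SupportedOn (_≡ 1) X
  X-supported zero          _ _   = m∣0
  X-supported (suc zero)    _ 1≢1 = contradiction ≡.refl 1≢1
  X-supported (suc (suc n)) _ _   = m∣0

-- The generating function

copies : ℕ → ℕ → ℕ
copies n k = sum (map (λ i → rdUpTo (n ℕ.∸ i ℕ.* suc k) k) (filter (λ i → i ℕ.* suc k ≤? n) (upTo 9)))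

-- The definition splits on n before k, so this equation computes only after a case split on n.
rdUpTo-suc : ∀ n k → rdUpTo n (suc k) ≡ (if does (4 ℕ.∣? suc k) then rdUpTo n k else copies n k)
rdUpTo-suc zero    k = ≡.refl
rdUpTo-suc (suc n) k = ≡.refl

module GeneratingFunction (m : ℤ.ℤ) (N : ℕ) where
  open Convolution
  open TruncatedSeries m N
  open RingBase seriesRing
  open ThetaSeries seriesRing using (D; ^-kills)
  open Support m N

  rd : ℕ → Series
  rd k n = ℤ.+ rdUpTo n k

  X^⊛-≥ : ∀ s f {n} → s ≤ n → (X ^ s * f) n ≡ f (n ℕ.∸ s)
  X^⊛-≥ zero    f {n} s≤n       = ⊛-identityˡ f n
  X^⊛-≥ (suc s) f {suc n} (s≤s s≤n) = ≡.trans (⊛-assoc X (X ^ s) f (suc n))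
    (≡.trans (X⊛-suc (X ^ s * f) n) (X^⊛-≥ s f s≤n))

  X^⊛-< : ∀ s f {n} → n < s → (X ^ s * f) n ≡ ℤ.0ℤ
  X^⊛-< (suc s) f {zero}  n<s       = ⊛-assoc X (X ^ s) f 0
  X^⊛-< (suc s) f {suc n} (s≤s n<s) = ≡.trans (⊛-assoc X (X ^ s) f (suc n))
    (≡.trans (X⊛-suc (X ^ s * f) n) (X^⊛-< s f n<s))

  -- Entries removed by the filter become zero summands. The enumeration e is arbitrary because the
  -- tail of `applyUpTo e` enumerates `e ∘ suc`.
  sum-filter : ∀ K (e h : ℕ → ℕ) {P : Pred ℕ 0ℓ} (P? : Decidable P) (F : ℕ → Series) n →
    (∀ i → F i n ≡ (if does (P? (e i)) then ℤ.+ h (e i) else ℤ.0ℤ)) →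
    ℤ.+ sum (map h (filter P? (applyUpTo e K))) ≡ ∑ K F n
  sum-filter zero    e h P? F n eq = ≡.refl
  sum-filter (suc K) e h P? F n eq with does (P? (e 0)) | eq 0
  ... | true  | F₀n≡h = ≡.trans (ℤ.pos-+ (h (e 0)) _)
    (≡.cong₂ ℤ._+_ (≡.sym F₀n≡h) (sum-filter K (e ∘ suc) h P? (F ∘ suc) n (eq ∘ suc)))
  ... | false | F₀n≡0 = ≡.trans (sum-filter K (e ∘ suc) h P? (F ∘ suc) n (eq ∘ suc))
    (≡.trans (≡.sym (ℤ.+-identityˡ _)) (≡.cong (ℤ._+ ∑ K (F ∘ suc) n) (≡.sym F₀n≡0)))

  X^⊛-if : ∀ s (f : ℕ → ℕ) n → (X ^ s * (λ i → ℤ.+ f i)) n ≡ (if does (s ≤? n) then ℤ.+ f (n ℕ.∸ s) else ℤ.0ℤ)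
  X^⊛-if s f n with s ≤? n
  ... | yes s≤n rewrite dec-true (s ≤? n) s≤n = X^⊛-≥ s _ s≤n
  ... | no  s≰n rewrite dec-false (s ≤? n) s≰n = X^⊛-< s _ (ℕ.≰⇒> s≰n)

  rd-regular : ∀ k → does (4 ℕ.∣? suc k) ≡ true → rd (suc k) ≈ rd k
  rd-regular k 4∣k = pointwise λ n → ≡.cong ℤ.+_ (≡.trans (rdUpTo-suc n k)
    (≡.cong (λ b → if b then rdUpTo n k else copies n k) 4∣k))

  rd-distinct : ∀ k → does (4 ℕ.∣? suc k) ≡ false → rd (suc k) ≈ rd k * ∑ 9 ((X ^ suc k) ^_)
  rd-distinct k 4∤k = begin
    rd (suc k)                                      ≈⟨ pointwise (λ n → ≡.trans
      (≡.cong ℤ.+_ (≡.trans (rdUpTo-suc n k) (≡.cong (λ b → if b then rdUpTo n k else copies n k) 4∤k)))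
      (sum-filter 9 (λ i → i) (λ i → rdUpTo (n ℕ.∸ i ℕ.* suc k) k) (λ i → i ℕ.* suc k ≤? n)
        (λ i → X ^ (i ℕ.* suc k) * rd k) n (λ i → X^⊛-if (i ℕ.* suc k) (λ j → rdUpTo j k) n))) ⟩
    ∑ 9 (λ i → X ^ (i ℕ.* suc k) * rd k)            ≈⟨ ∑-cong 9 {λ i → X ^ (i ℕ.* suc k) * rd k} {λ i → rd k * (X ^ suc k) ^ i}
      (λ i → trans (*-comm (X ^ (i ℕ.* suc k)) (rd k)) (*-congˡ
      (trans (^-≡ X (ℕ.*-comm i (suc k))) (sym (^-assocʳ X (suc k) i))))) ⟩
    ∑ 9 (λ i → rd k * (X ^ suc k) ^ i)              ≈⟨ ∑-*ˡ 9 (rd k) ((X ^ suc k) ^_) ⟩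
    rd k * ∑ 9 ((X ^ suc k) ^_)                     ∎

  factor : Series → ℕ → Series
  factor x j = if does (4 ℕ.∣? suc j) then 1# else 1# - x ^ suc j

  -- Multiplicities 0 to 8 contribute a geometric sum of nine terms, the quotient of 1 - q^(9j) by 1
  -- - q^j at j = k + 1; denominators are cleared.
  rd-factor : ∀ k → rd (suc k) * factor X k ≈ rd k * factor (X ^ 9) k
  rd-factor k with does (4 ℕ.∣? suc k) in eq
  ... | true  = *-congʳ (rd-regular k eq)
  ... | false = begin
    rd (suc k) * (1# - X ^ suc k)                                  ≈⟨ *-congʳ (rd-distinct k eq) ⟩
    rd k * ∑ 9 ((X ^ suc k) ^_) * (1# - X ^ suc k)                 ≈⟨ *-assoc _ _ _ ⟩
    rd k * (∑ 9 ((X ^ suc k) ^_) * (1# - X ^ suc k))               ≈⟨ *-congˡ (geometric-quotient 9 (X ^ suc k)) ⟩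
    rd k * (1# - (X ^ suc k) ^ 9)                                  ≈⟨ *-congˡ (1-cong (trans (^-assocʳ X (suc k) 9)
      (trans (^-≡ X (ℕ.*-comm (suc k) 9)) (sym (^-assocʳ X 9 (suc k)))))) ⟩
    rd k * (1# - (X ^ 9) ^ suc k)                                  ∎

  rd-product : ∀ k → rd k * ∏ k (factor X) ≈ ∏ k (factor (X ^ 9))
  rd-product zero    = trans (*-identityʳ _) (pointwise λ { zero → ≡.refl ; (suc n) → ≡.refl })
  rd-product (suc k) = begin
    rd (suc k) * ∏ (suc k) (factor X)                ≈⟨ *-congˡ (∏-last k (factor X)) ⟩
    rd (suc k) * (∏ k (factor X) * factor X k)       ≈⟨ solve 3 (λ g p d → g :* (p :* d) := g :* d :* p) refl _ _ _ ⟩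
    rd (suc k) * factor X k * ∏ k (factor X)         ≈⟨ *-congʳ (rd-factor k) ⟩
    rd k * factor (X ^ 9) k * ∏ k (factor X)         ≈⟨ solve 3 (λ g p d → g :* p :* d := g :* d :* p) refl _ _ _ ⟩
    rd k * ∏ k (factor X) * factor (X ^ 9) k         ≈⟨ *-congʳ (rd-product k) ⟩
    ∏ k (factor (X ^ 9)) * factor (X ^ 9) k          ≈⟨ ∏-last k (factor (X ^ 9)) ⟨
    ∏ (suc k) (factor (X ^ 9))                       ∎

  -- Factors with index at least N contain x^(N+1) or a higher power, or are 1 already, so N of them
  -- may be completed to N + 1 full blocks of four.
  ∏-factor : ∀ {x} → suc N Kills x → ∏ N (factor x) ≈ D (suc N) x
  ∏-factor {x} kill = begin
    ∏ N (factor x)                                  ≈⟨ ∏-stable (factor x) N≤[1+N]*4 factor≈1 ⟨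
    ∏ (suc N ℕ.* 4) (factor x)                      ≈⟨ ∏-blocks (suc N) 4 (factor x) ⟩
    ∏ (suc N) (λ k → ∏ 4 (λ r → factor x (r ℕ.+ k ℕ.* 4))) ≈⟨ ∏-cong (suc N) block ⟩
    D (suc N) x                                     ∎
    where
    N≤[1+N]*4 : N ≤ suc N ℕ.* 4
    N≤[1+N]*4 = ℕ.≤-trans (ℕ.n≤1+n N) (ℕ.m≤m*n (suc N) 4)
    factor≈1 : ∀ j → N ≤ j → factor x j ≈ 1#
    factor≈1 j N≤j with does (4 ℕ.∣? suc j)
    ... | true  = refl
    ... | false = 1-≈1 (^-vanish kill (s≤s N≤j))
    indivisible : ∀ r k → ¬ (4 ℕ.∣ suc r) → does (4 ℕ.∣? suc (r ℕ.+ k ℕ.* 4)) ≡ false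
    indivisible r k 4∤1+r = dec-false (4 ℕ.∣? suc (r ℕ.+ k ℕ.* 4)) λ 4∣ →
      4∤1+r (ℕ.∣m+n∣m⇒∣n (≡.subst (4 ℕ.∣_) (ℕ.+-comm (suc r) (k ℕ.* 4)) 4∣) (ℕ.n∣m*n k))
    block : ∀ k → ∏ 4 (λ r → factor x (r ℕ.+ k ℕ.* 4)) ≈
      (1# - x ^ (1 ℕ.+ k ℕ.* 4)) * ((1# - x ^ (2 ℕ.+ k ℕ.* 4)) * ((1# - x ^ (3 ℕ.+ k ℕ.* 4)) * 1#))
    block k
      rewrite indivisible 0 k (from-no (4 ℕ.∣? 1))
            | indivisible 1 k (from-no (4 ℕ.∣? 2))
            | indivisible 2 k (from-no (4 ℕ.∣? 3))
            | dec-true (4 ℕ.∣? suc (3 ℕ.+ k ℕ.* 4)) (ℕ.n∣m*n (suc k))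
      = *-congˡ (*-congˡ (*-congˡ (*-identityˡ 1#)))

  -- Degrees above N are invisible, so bounding the parts by N loses nothing; the coefficient of
  -- `rd N` at N is `RD49 N` by definition.
  rdD≈D₉ : rd N * D (suc N) X ≈ D (suc N) (X ^ 9)
  rdD≈D₉ = begin
    rd N * D (suc N) X               ≈⟨ *-congˡ (∏-factor X-kill) ⟨
    rd N * ∏ N (factor X)            ≈⟨ rd-product N ⟩
    ∏ N (factor (X ^ 9))             ≈⟨ ∏-factor (^-kills 8 X-kill) ⟩
    D (suc N) (X ^ 9)                ∎
    where
    X-kill : suc N Kills X
    X-kill = kills-supported X-supported

-- Exponents of the generating function modulo 4

module _ (N : ℕ) where
  open import Data.Integer.Divisibility.Signed using (_∣_; divides; ∣m⇒∣-m; ∣m∣n⇒∣m-n; ∣m⇒∣m*n; ∣n⇒∣m*n; ∣⇒∣ᵤ)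
  open Convolution
  open TruncatedSeries (ℤ.+ 4) N
  open RingBase seriesRing
  open ThetaSeries seriesRing
  open Doubled seriesRing using (2AT≈2yψ₉)
  open Support (ℤ.+ 4) N
  open GeneratingFunction (ℤ.+ 4) N

  private
    y : Series
    y = - X

    K : ℕ
    K = suc N

    y-supported : SupportedOn (_≡ 1) y
    y-supported n n≤N n≢1 = ∣m⇒∣-m (X-supported n n≤N n≢1)

    correction : Series
    correction = y + (y * T K y + y * T K y)

    H : Series
    H = rd N + correction

    4≈0 : 1# + 1# + (1# + 1#) ≈ 0#
    4≈0 = coefficientwise λ { zero _ → divides ℤ.1ℤ ≡.refl ; (suc n) _ → divides ℤ.0ℤ ≡.refl }

    ψ₉H≈A : ψ K (y ^ 9) * H ≈ A K y
    ψ₉H≈A = mod4-identity 4≈0 (pointwise λ _ → ≡.refl) y-kill rdD≈D₉ (2AT≈2yψ₉ 4≈0 y-kill)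
      where
      y-kill : K Kills y
      y-kill = kills-supported y-supported

    3∣6i+9j : ∀ i j → 3 ℕ.∣ 6 ℕ.* i ℕ.+ 9 ℕ.* j
    3∣6i+9j i j = ℕ.divides (2 ℕ.* i ℕ.+ 3 ℕ.* j) (rearrange i j)
      where
      rearrange : ∀ i j → 6 ℕ.* i ℕ.+ 9 ℕ.* j ≡ (2 ℕ.* i ℕ.+ 3 ℕ.* j) ℕ.* 3
      rearrange = solve-∀

    A-supported : SupportedOn (3 ℕ.∣_) (A K y)
    A-supported = supported-∑ K λ i → supported-⊕
      (supported-mono (λ { _ ≡.refl → 3∣C₂[1+3i] i }) (supported-^ y-supported (C₂ (1 ℕ.+ i ℕ.* 3))))
      (supported-mono (λ { _ ≡.refl → 3∣C₂[3+3i] i }) (supported-^ y-supported (C₂ (3 ℕ.+ i ℕ.* 3))))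
      where
      3∣C₂[1+3i] : ∀ i → 3 ℕ.∣ C₂ (1 ℕ.+ i ℕ.* 3)
      3∣C₂[1+3i] i = ≡.subst (3 ℕ.∣_) (≡.sym (C₂-progression 3 i)) (3∣6i+9j i (C₂ i))
      rearrange : ∀ i c → (1 ℕ.+ 2 ℕ.* i) ℕ.* 3 ℕ.+ c ≡ 2 ℕ.+ i ℕ.* 3 ℕ.+ (1 ℕ.+ i ℕ.* 3 ℕ.+ c)
      rearrange = solve-∀
      3∣C₂[3+3i] : ∀ i → 3 ℕ.∣ C₂ (3 ℕ.+ i ℕ.* 3)
      3∣C₂[3+3i] i = ≡.subst (3 ℕ.∣_) (rearrange i (C₂ (1 ℕ.+ i ℕ.* 3)))
        (ℕ.∣m∣n⇒∣m+n (ℕ.n∣m*n (1 ℕ.+ 2 ℕ.* i)) (3∣C₂[1+3i] i))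

    -- ψ(y⁹) without its constant term: as K is `suc N`, `ψ K (y ^ 9)` unfolds to `1# + ψ₉-tail`.
    ψ₉-tail : Series
    ψ₉-tail = ∑ N (λ n → (y ^ 9) ^ C₂ (suc (suc n)))

    ψ₉-tail-supported : SupportedOn (λ n → 3 ℕ.∣ n × n ≢ 0) ψ₉-tail
    ψ₉-tail-supported = supported-∑ N λ i → supported-mono
      (λ { _ ≡.refl → ℕ.∣m⇒∣m*n (C₂ (suc (suc i))) (ℕ.divides 3 ≡.refl) , λ () })
      (supported-^^ y-supported 9 (C₂ (suc (suc i))))

    H+tailH≈A : H + ψ₉-tail * H ≈ A K y
    H+tailH≈A = begin
      H + ψ₉-tail * H          ≈⟨ +-congʳ (*-identityˡ H) ⟨
      1# * H + ψ₉-tail * H     ≈⟨ distribʳ H 1# ψ₉-tail ⟨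
      (1# + ψ₉-tail) * H       ≈⟨ ψ₉H≈A ⟩
      A K y                    ∎

    -- Division by ψ(y⁹) as a recursion on degrees: H n = A n - (ψ₉-tail * H) n. The tail only has
    -- positive exponents divisible by 3, so for n prime to 3 the product involves, modulo 4, only H
    -- j with j < n and j prime to 3.
    H-supported : SupportedOn (3 ℕ.∣_) H
    H-supported = <-rec (λ n → n ≤ N → ¬ (3 ℕ.∣ n) → ℤ.+ 4 ∣ H n) step
      where
      step : ∀ n → (∀ {k} → k < n → k ≤ N → ¬ (3 ℕ.∣ k) → ℤ.+ 4 ∣ H k) → n ≤ N → ¬ (3 ℕ.∣ n) → ℤ.+ 4 ∣ H n
      step n IH n≤N 3∤n = ≡.subst (ℤ.+ 4 ∣_) (cancel (H n) ((ψ₉-tail * H) n))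
        (∣m∣n⇒∣m-n (supported-≋ {3 ℕ.∣_} H+tailH≈A A-supported n n≤N 3∤n) (∣-⊛ n summand))
        where
        cancel : ∀ a b → (a ℤ.+ b) ℤ.- b ≡ a
        cancel = ℤSolver.solve-∀
        summand : ∀ i j → i ℕ.+ j ≡ n → ℤ.+ 4 ∣ ψ₉-tail i ℤ.* H j
        summand zero    j i+j≡n = ∣m⇒∣m*n (H j) (ψ₉-tail-supported 0 z≤n λ (_ , 0≢0) → 0≢0 ≡.refl)
        summand (suc i) j ≡.refl with 3 ℕ.∣? suc i
        ... | no  3∤1+i = ∣m⇒∣m*n (H j) (ψ₉-tail-supported (suc i) (ℕ.m+n≤o⇒m≤o (suc i) n≤N) λ (3∣1+i , _) → 3∤1+i 3∣1+i)
        ... | yes 3∣1+i = ∣n⇒∣m*n (ψ₉-tail (suc i))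
          (IH (s≤s (ℕ.m≤n+m j i)) (ℕ.m+n≤o⇒n≤o (suc i) n≤N) λ 3∣j → 3∤n (ℕ.∣m∣n⇒∣m+n 3∣1+i 3∣j))

    Exceptional : ℕ → Set
    Exceptional n = n ≡ 1 ⊎ ∃ λ k → ¬ (3 ℕ.∣ k) × n ≡ suc (k ℕ.* k)

    correction-supported : SupportedOn Exceptional correction
    correction-supported = supported-⊕ (supported-mono (λ _ → inj₁) y-supported) (supported-⊕ yT-supported yT-supported)
      where
      yT-supported : SupportedOn Exceptional (y * T K y)
      yT-supported = supported-≋ (sym (∑-*ˡ K y λ i → y ^ sq (1 ℕ.+ i ℕ.* 3) + y ^ sq (2 ℕ.+ i ℕ.* 3)))
        (supported-∑ K λ i → supported-≋ (distribˡ y (y ^ sq (1 ℕ.+ i ℕ.* 3)) (y ^ sq (2 ℕ.+ i ℕ.* 3)))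
          (supported-⊕ (power 1 i (from-no (3 ℕ.∣? 1))) (power 2 i (from-no (3 ℕ.∣? 2)))))
        where
        sq : ℕ → ℕ
        sq n = n ℕ.* n
        power : ∀ r i → ¬ (3 ℕ.∣ r) → SupportedOn Exceptional (y ^ suc (sq (r ℕ.+ i ℕ.* 3)))
        power r i 3∤r = supported-mono
          (λ { _ ≡.refl → inj₂ (r ℕ.+ i ℕ.* 3 , (λ 3∣ → 3∤r (ℕ.∣m+n∣m⇒∣n (≡.subst (3 ℕ.∣_) (ℕ.+-comm r (i ℕ.* 3)) 3∣) (ℕ.n∣m*n i))) , ≡.refl) })
          (supported-^ y-supported (suc (sq (r ℕ.+ i ℕ.* 3))))

  4∣RD49 : ¬ (3 ℕ.∣ N) → N ≢ 1 → (∀ k → ¬ (3 ℕ.∣ k) → N ≢ suc (k ℕ.* k)) → 4 ℕ.∣ RD49 N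
  4∣RD49 3∤N N≢1 N-1≢k² = ∣⇒∣ᵤ (≡.subst (ℤ.+ 4 ∣_) (cancel (rd N N) (correction N))
    (∣m∣n⇒∣m-n (H-supported N ℕ.≤-refl 3∤N)
      (correction-supported N ℕ.≤-refl λ { (inj₁ N≡1) → N≢1 N≡1 ; (inj₂ (k , 3∤k , N≡)) → N-1≢k² k 3∤k N≡ })))
    where
    cancel : ∀ a b → (a ℤ.+ b) ℤ.- b ≡ a
    cancel = ℤSolver.solve-∀

-- Arithmetic of the arguments in the theorem

open import Data.Nat using (_+_; _*_; _^_; _∸_; _%_)
open import Data.Nat.Divisibility using (_∣_; _∣?_)

-- -1 is not a square modulo 3, and n² + 1 modulo 3 has period 3 in n.
3∤n²+1 : ∀ n → ¬ (3 ∣ n * n + 1)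
3∤n²+1 zero                = from-no (3 ∣? 1)
3∤n²+1 (suc zero)          = from-no (3 ∣? 2)
3∤n²+1 (suc (suc zero))    = from-no (3 ∣? 5)
3∤n²+1 (suc (suc (suc n))) 3∣ = 3∤n²+1 n
  (ℕ.∣m+n∣m⇒∣n (≡.subst (3 ∣_) (rearrange n) 3∣) (ℕ.m∣m*n (3 + 2 * n)))
  where
  rearrange : ∀ n → (3 + n) * (3 + n) + 1 ≡ 3 * (3 + 2 * n) + (n * n + 1)
  rearrange = solve-∀

-- Descent: p divides k, and cancelling p² lowers α by one, until p q² = u contradicts `¬ (p ∣ u)`.
-- Writing `α * 2` lets the exponent at `suc α` compute to two further successors.
odd-valuation-nonsquare : ∀ {p u} → Prime p → ¬ (p ∣ u) → ∀ α k → k * k ≢ p ^ suc (α * 2) * u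
odd-valuation-nonsquare {p} {u} pp p∤u α k k²≡ = descend α p∣k k²≡
  where
  instance
    p≢0 : ℕ.NonZero p
    p≢0 = prime⇒nonZero pp
  p∣k : p ∣ k
  p∣k = [ id , id ]′ (euclidsLemma k k pp
    (≡.subst (p ∣_) (≡.sym k²≡) (ℕ.∣m⇒∣m*n u (ℕ.m∣m*n (p ^ (α * 2))))))
  assoc₁ : ∀ p q → q * p * (q * p) ≡ p * (p * (q * q))
  assoc₁ = solve-∀
  assoc₂ : ∀ p r u → p * (p * (p * r)) * u ≡ p * (p * (p * r * u))
  assoc₂ = solve-∀
  descend : ∀ α {k} → p ∣ k → k * k ≢ p ^ suc (α * 2) * u
  descend zero    (ℕ.divides q ≡.refl) k²≡ = p∤u (ℕ.divides (q * q) (≡.trans (≡.sym pq²≡u) (ℕ.*-comm p (q * q))))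
    where
    pq²≡u : p * (q * q) ≡ u
    pq²≡u = ℕ.*-cancelˡ-≡ (p * (q * q)) u p (≡.trans (≡.sym (assoc₁ p q)) (≡.trans k²≡ (≡.cong (_* u) (ℕ.*-identityʳ p))))
  descend (suc α) (ℕ.divides q ≡.refl) k²≡ = odd-valuation-nonsquare pp p∤u α q
    (ℕ.*-cancelˡ-≡ _ _ p (ℕ.*-cancelˡ-≡ _ _ p
      (≡.trans (≡.sym (assoc₁ p q)) (≡.trans k²≡ (assoc₂ p (p ^ (α * 2)) u)))))

-- The prime divisors of 12 are 2 and 3, and the congruence excludes 2.
p≡3[4]∧p∣12⇒p≡3 : ∀ {p} → Prime p → p % 4 ≡ 3 → p ∣ 12 → p ≡ 3
p≡3[4]∧p∣12⇒p≡3 {p} pp p%4≡3 p∣12 with euclidsLemma 3 4 pp p∣12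
... | inj₁ p∣3 = at-most-3 (ℕ.∣⇒≤ p∣3) p%4≡3
  where
  at-most-3 : ∀ {p} → p ≤ 3 → p % 4 ≡ 3 → p ≡ 3
  at-most-3 z≤n                         ()
  at-most-3 (s≤s z≤n)                   ()
  at-most-3 (s≤s (s≤s z≤n))             ()
  at-most-3 (s≤s (s≤s (s≤s z≤n)))       _  = ≡.refl
... | inj₂ p∣4 with [ id , id ]′ (euclidsLemma 2 2 pp p∣4)
...   | p∣2 = contradiction p%4≡3 (at-most-2 (ℕ.∣⇒≤ p∣2))
  where
  at-most-2 : ∀ {p} → p ≤ 2 → p % 4 ≢ 3
  at-most-2 z≤n             ()
  at-most-2 (s≤s z≤n)       ()
  at-most-2 (s≤s (s≤s z≤n)) ()

-- Modulo p the number is 12 i, where p does not divide 12 and 0 < i < p.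
p∤12[pn+i]+p : ∀ {p} → Prime p → p % 4 ≡ 3 → p ≢ 3 → ∀ n i → 1 ≤ i → i ≤ p ∸ 1 → ¬ (p ∣ 12 * (p * n + i) + p)
p∤12[pn+i]+p {p} pp p%4≡3 p≢3 n i 1≤i i≤p-1 p∣ =
  [ p≢3 ∘ p≡3[4]∧p∣12⇒p≡3 pp p%4≡3 , p∤pn+i ]′ (euclidsLemma 12 (p * n + i) pp
    (ℕ.∣m+n∣m⇒∣n (≡.subst (p ∣_) (ℕ.+-comm _ p) p∣) ℕ.∣-refl))
  where
  instance
    p≢0 : ℕ.NonZero p
    p≢0 = prime⇒nonZero pp
    i≢0 : ℕ.NonZero i
    i≢0 = ℕ.>-nonZero 1≤i
  p∤pn+i : ¬ (p ∣ p * n + i)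
  p∤pn+i p∣pn+i = ℕ.<⇒≱ (ℕ.m≤pred[n]⇒suc[m]≤n i≤p-1) (ℕ.∣⇒≤ (ℕ.∣m+n∣m⇒∣n p∣pn+i (ℕ.m∣m*n n)))

theorem3p1 : (p : ℕ) → Prime p → p % 4 ≡ 3 →
    (α n i : ℕ) → 1 ≤ i → i ≤ p ∸ 1 →
    4 ∣ RD49 (12 * p ^ (2 * α + 1) * (p * n + i) + p ^ (2 * α + 2) + 1)
theorem3p1 p pp p%4≡3 α n i 1≤i i≤p-1 = 4∣RD49 (M + 1) 3∤M+1 M+1≢1 M+1≢1+k²
  where
  instance
    p≢0 : ℕ.NonZero p
    p≢0 = prime⇒nonZero pp
  j = p * n + i
  M = 12 * p ^ (2 * α + 1) * j + p ^ (2 * α + 2)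

  M≡ : M ≡ p ^ suc (α * 2) * (12 * j + p)
  M≡ = ≡.trans (≡.cong₂ (λ a b → 12 * p ^ a * j + p ^ b) (odd α) (even α)) (rearrange (p ^ (α * 2)) p j)
    where
    odd : ∀ α → 2 * α + 1 ≡ suc (α * 2)
    odd = solve-∀
    even : ∀ α → 2 * α + 2 ≡ suc (suc (α * 2))
    even = solve-∀
    rearrange : ∀ q p j → 12 * (p * q) * j + p * (p * q) ≡ p * q * (12 * j + p)
    rearrange = solve-∀

  3∤M+1 : ¬ (3 ∣ M + 1)
  -- The summand with factor 12 vanishes modulo 3, and p^(2α+2) is the square of p^(α+1).
  3∤M+1 3∣M+1 = 3∤n²+1 (p ^ (α + 1)) (ℕ.∣m+n∣m⇒∣n
    (≡.subst (3 ∣_) M+1≡ 3∣M+1) (ℕ.∣m⇒∣m*n j (ℕ.∣m⇒∣m*n (p ^ (2 * α + 1)) (ℕ.divides 4 ≡.refl))))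
    where
    double : ∀ α → 2 * α + 2 ≡ (α + 1) + (α + 1)
    double = solve-∀
    M+1≡ : M + 1 ≡ 12 * p ^ (2 * α + 1) * j + (p ^ (α + 1) * p ^ (α + 1) + 1)
    M+1≡ = ≡.trans (ℕ.+-assoc _ (p ^ (2 * α + 2)) 1)
      (≡.cong (λ e → 12 * p ^ (2 * α + 1) * j + (e + 1))
        (≡.trans (≡.cong (p ^_) (double α)) (ℕ.^-distribˡ-+-* p (α + 1) (α + 1))))

  M+1≢1 : M + 1 ≢ 1
  M+1≢1 M+1≡1 = ℕ.≢-nonZero⁻¹ (p ^ (2 * α + 2)) {{ℕ.m^n≢0 p (2 * α + 2)}}
    (ℕ.m+n≡0⇒n≡0 (12 * p ^ (2 * α + 1) * j) (ℕ.+-cancelʳ-≡ 1 M 0 M+1≡1))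

  M+1≢1+k² : ∀ k → ¬ (3 ∣ k) → M + 1 ≢ suc (k * k)
  M+1≢1+k² k 3∤k M+1≡1+k² with p ℕ.≟ 3
  ... | no p≢3     = odd-valuation-nonsquare pp (p∤12[pn+i]+p pp p%4≡3 p≢3 n i 1≤i i≤p-1) α k k²≡
    where
    k²≡ : k * k ≡ p ^ suc (α * 2) * (12 * j + p)
    k²≡ = ≡.trans (≡.sym (ℕ.suc-injective (≡.trans (ℕ.+-comm 1 M) M+1≡1+k²))) M≡
  -- For p = 3 the valuation argument fails because 3 divides 12; instead 3 divides M, whereas the
  -- exceptional k is prime to 3.
  ... | yes ≡.refl = [ 3∤k , 3∤k ]′ (euclidsLemma k k pp (≡.subst (3 ∣_) k²≡
      (ℕ.∣m⇒∣m*n (12 * j + 3) (ℕ.m∣m*n (3 ^ (α * 2))))))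
    where
    k²≡ : 3 ^ suc (α * 2) * (12 * j + 3) ≡ k * k
    k²≡ = ≡.trans (≡.sym M≡) (ℕ.suc-injective (≡.trans (ℕ.+-comm 1 M) M+1≡1+k²))
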